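{- Let $r\ge1$, let $\mathbf{n}=(n_1,\ldots,n_r)$ be a vector of positive integers, $n=n_1+\cdots+n_r$, and let $\boldsymbol{\alpha}=(\alpha_1,\ldots,\alpha_r)$ be real with $\alpha_j>-1$ for $j=1,\ldots,r$. (i) If $\beta>-1$, then all zeros of the Jacobi–Piñeiro polynomial $P_{\mathbf{n}}^{(\boldsymbol{\alpha},\beta)}$ lie in $(0,1)$. (ii) If $-2<\beta\le-1$, then all zeros of $P_{\mathbf{n}}^{(\boldsymbol{\alpha},\beta)}$ but one lie in $(0,1)$, and the remaining zero lies in $[1,\infty)$.
   Context: $(b)_k=b(b+1)\cdots(b+k-1)$, $(b)_0=1$, is the Pochhammer symbol. The Jacobi–Piñeiro polynomial is defined (for canonical as well as non-canonical parameter values) by $$P_{\mathbf{n}}^{(\boldsymbol{\alpha},\beta)}(x)=\frac{(-1)^n\prod_{j=1}^r(\alpha_j+1)_{n_j}}{\prod_{j=1}^r(n+\alpha_j+\beta+1)_{n_j}}\,(1-x)^{ -\beta}\;{}_{r+1}F_r\!\left(\begin{array}{c}-n-\beta,\,\alpha_1+n_1+1,\ldots,\alpha_r+n_r+1\\ \alpha_1+1,\ldots,\alpha_r+1\end{array}\Big|\,x\right),$$ where ${}_{r+1}F_r\!\left(\begin{array}{c}a_0,\ldots,a_r\\ b_1,\ldots,b_r\end{array}\Big|\,x\right)=\sum_{k\ge0}\frac{(a_0)_k\cdots(a_r)_k}{(b_1)_k\cdots(b_r)_k\,k!}x^k$. The right-hand side is a polynomial in $x$ of degree at most $n$ (the identity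 is understood as one of power series at $0$). Zeros are counted with multiplicity. No condition $\alpha_i-\alpha_j\notin\mathbb{Z}$ is imposed.
   Formalization: In (ii), when n = 1, the condition α₁+β+2 > 0 is added: the only zero is (α₁+1)/(α₁+β+2), which is negative if α₁+β+2 < 0 (e.g. −1/8 for α₁ = −9/10, β = −19/10), and the polynomial is undefined if α₁+β+2 = 0. -}

module Defs where

open import Algebra.Bundles using (CommutativeRing; Semiring)
open import Algebra.Core using (Op₁; Op₂)
open import Algebra.Structures using (IsCommutativeRing)
open import Data.List.Base using (List; []; _∷_)
open import Data.Nat.Base as ℕ using (ℕ; zero; suc; _∸_; _!)
open import Data.Fin.Base using (toℕ)
open import Data.Product.Base using (∃-syntax; _×_)
open import Data.Vec.Functional as Vector using (Vector)
open import Level as Level using (0ℓ)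
open import Relation.Binary.Core using (Rel)
open import Relation.Binary.Structures using (IsStrictTotalOrder)
open import Relation.Nullary.Negation using (¬_)
open import Relation.Unary using (Pred; Satisfiable)
import Algebra.Definitions.RawMonoid as RawMonoidDefinitions
import Algebra.Definitions.RawSemiring as RawSemiringDefinitions
import Relation.Binary.Construct.StrictToNonStrict as StrictToNonStrict

-- The real numbers, given by their classical characterisation as the
-- (unique up to isomorphism) ordered field with least upper bounds.
record CompleteOrderedField : Set (Level.suc 0ℓ) where
  infix  8 _⁻¹
  infix  8 -_
  infixl 7 _*_
  infixl 6 _+_
  infix  4 _≈_ _<_
  field
    Carrier : Set
    _≈_     : Rel Carrier 0ℓ
    _<_     : Rel Carrier 0ℓ
    _+_     : Op₂ Carrier
    _*_     : Op₂ Carrier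
    -_      : Op₁ Carrier
    -- Total for convenience; the value at 0# is unconstrained.
    _⁻¹     : Op₁ Carrier
    0#      : Carrier
    1#      : Carrier

    isCommutativeRing  : IsCommutativeRing _≈_ _+_ _*_ -_ 0# 1#
    0≉1                : ¬ (0# ≈ 1#)
    ⁻¹-cong            : ∀ {x y} → x ≈ y → x ⁻¹ ≈ y ⁻¹
    ⁻¹-inverseʳ        : ∀ {x} → ¬ (x ≈ 0#) → x * x ⁻¹ ≈ 1#

    isStrictTotalOrder : IsStrictTotalOrder _≈_ _<_
    +-monoʳ-<          : ∀ x {y z} → y < z → x + y < x + z
    *-positive         : ∀ {x y} → 0# < x → 0# < y → 0# < x * y

  open StrictToNonStrict _≈_ _<_ public using (_≤_)

  UpperBound : Pred Carrier 0ℓ → Pred Carrier 0ℓ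
  UpperBound S u = ∀ {x} → S x → x ≤ u

  field
    supremum : (S : Pred Carrier 0ℓ) → Satisfiable S → Satisfiable (UpperBound S) →
               ∃[ s ] UpperBound S s × (∀ {u} → UpperBound S u → s ≤ u)

  commutativeRing : CommutativeRing 0ℓ 0ℓ
  commutativeRing = record { isCommutativeRing = isCommutativeRing }

  open CommutativeRing commutativeRing public
    using (_-_; semiring; +-rawMonoid; *-rawMonoid)

∣_∣ : ∀ {r} → Vector ℕ r → ℕ
∣ 𝐧 ∣ = Vector.foldr ℕ._+_ 0 𝐧

module JacobiPiñeiro (ℝ : CompleteOrderedField) where

  open CompleteOrderedField ℝ public

  open RawMonoidDefinitions +-rawMonoid using (sum) renaming (_×_ to _·_)
  open RawMonoidDefinitions *-rawMonoid using () renaming (sum to product)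
  open RawSemiringDefinitions (Semiring.rawSemiring semiring) using (_^_)

  fromℕ : ℕ → Carrier
  fromℕ m = m · 1#

  pochhammer : Carrier → ℕ → Carrier
  pochhammer b zero    = 1#
  pochhammer b (suc k) = pochhammer b k * (b + fromℕ k)

  -- A formal power series is the sequence of its coefficients.
  PowerSeries : Set → Set
  PowerSeries A = ℕ → A

  infixl 7 _⊛_

  _⊛_ : PowerSeries Carrier → PowerSeries Carrier → PowerSeries Carrier
  (f ⊛ g) k = sum {suc k} (λ i → f (toℕ i) * g (k ∸ toℕ i))

  -- The binomial series (1 - x)^γ = Σ (-γ)_k / k! x^k.
  [1-x]^_ : Carrier → PowerSeries Carrier
  ([1-x]^ γ) k = pochhammer (- γ) k * fromℕ (k !) ⁻¹

  hypergeometric : ∀ {p q} → Vector Carrier p → Vector Carrier q → PowerSeries Carrier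
  hypergeometric a b k =
    product (λ i → pochhammer (a i) k) *
    (product (λ j → pochhammer (b j) k) * fromℕ (k !)) ⁻¹

  -- The Jacobi–Piñeiro polynomial, as its power series at 0.  The inverted factors
  -- are nonzero whenever α j > -1 and n + α j + β + 1 > 0 for all j; for n ≥ 2 the
  -- latter follows from α j > -1 and β > -2.
  P : ∀ {r} → Vector ℕ r → Vector Carrier r → Carrier → PowerSeries Carrier
  P 𝐧 α β k =
    ((- 1#) ^ n * product (λ j → pochhammer (α j + 1#) (𝐧 j))) *
    product (λ j → pochhammer (fromℕ n + α j + β + 1#) (𝐧 j)) ⁻¹ *
    ([1-x]^ (- β) ⊛
     hypergeometric
       ((- fromℕ n - β) Vector.∷ (λ j → α j + fromℕ (𝐧 j) + 1#))
       (λ j → α j + 1#)) k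
    where n = ∣ 𝐧 ∣

  infix 5 _+i_

  record ℂ : Set where
    constructor _+i_
    field
      re : Carrier
      im : Carrier

  open ℂ public

  infix  4 _≈ᶜ_
  infixl 6 _-ᶜ_
  infixl 7 _*ᶜ_

  _≈ᶜ_ : Rel ℂ 0ℓ
  z ≈ᶜ w = re z ≈ re w × im z ≈ im w

  ofReal : Carrier → ℂ
  ofReal x = x +i 0#

  _-ᶜ_ : Op₂ ℂ
  z -ᶜ w = (re z - re w) +i (im z - im w)

  _*ᶜ_ : Op₂ ℂ
  z *ᶜ w = (re z * re w - im z * im w) +i (re z * im w + im z * re w)

  -- Coefficients of the product of the linear factors x - z, for z in the list.
  ∏[x-_] : List ℂ → PowerSeries ℂ
  ∏[x- []     ] zero    = ofReal 1#
  ∏[x- []     ] (suc k) = ofReal 0#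
  ∏[x- z ∷ zs ] zero    = ofReal 0# -ᶜ z *ᶜ ∏[x- zs ] zero
  ∏[x- z ∷ zs ] (suc k) = ∏[x- zs ] k -ᶜ z *ᶜ ∏[x- zs ] (suc k)

  -- f is a nonzero polynomial, and zs lists all its complex zeros, each as often
  -- as its multiplicity.  By unique factorisation zs is determined by f up to
  -- permutation.
  _HasZeros_ : PowerSeries Carrier → List ℂ → Set
  f HasZeros zs = ∃[ c ] ¬ (c ≈ᶜ ofReal 0#) × (∀ k → ofReal (f k) ≈ᶜ c *ᶜ ∏[x- zs ] k)

  ⟨0,1⟩ : Pred ℂ 0ℓ
  ⟨0,1⟩ z = im z ≈ 0# × 0# < re z × re z < 1#

  [1,∞⟩ : Pred ℂ 0ℓ
  [1,∞⟩ z = im z ≈ 0# × 1# ≤ re z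

module Submission where

-- Let θ = x d/dx.  Since (αⱼ+nⱼ+1)ₖ / (αⱼ+1)ₖ = (αⱼ+1+k)ₙⱼ / (αⱼ+1)ₙⱼ, the hypergeometric
-- series is, up to a positive factor, the image of (1-x)^(n+β) under the product of the n
-- commuting operators θ + a, where a runs through the numbers αⱼ + 1 + i with 0 ≤ i < nⱼ.
-- All these a are positive; their differences play no role.  This is a Rodrigues formula,
-- peeled into first-order steps: (θ + a) (p (1-x)^(γ+1)) = q (1-x)^γ for a polynomial p
-- and
--   q = T p = (1-x) (θ + a) p - (γ+1) x p,
-- so n steps starting from p = 1 give the Jacobi–Piñeiro polynomial up to a nonzero factor
-- (T-⊛, weight-[1-x]^, P-rodrigues).
--
-- One step creates one zero.  Let p be monic with simple zeros 1 > z₁ > ... > zₘ > 0. Then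
-- q(zᵢ) = zᵢ (1 - zᵢ) p′(zᵢ) and q(0) = a p(0), so q alternates in sign along z₁, ..., zₘ,
-- 0, beginning with a positive value (T∏-alternating), while q(1) = -(γ+1) p(1). If γ >
-- -1, then q(1) < 0 makes one more sign change, and the intermediate value theorem gives m
-- + 1 zeros in (0,1), which is as many as the degree permits (T∏-zeros).  For β > -1 every
-- step is of this kind.  If -2 < β ≤ -1, only the last step, the one with γ = β, is not:
-- there q has m zeros in (0,1), q(1) ≥ 0, and a leading coefficient -(n + a + β) < 0, so
-- the one zero left is real and at least 1 (T∏-zeros-beyond).  Here n + a + β > 0 is
-- automatic for n ≥ 2.
--
-- Polynomials are treated algebraically.  No derivative of p is needed: sign alternation
-- is proved by induction on the number of zeros through
--   T ((x-z) p) = (x-z) T p - x (x-1) p,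
-- adjoining the largest zero z last.  Zeros are split off one at a time by dividing by a
-- linear factor (peel, extract), and the intermediate value theorem follows from the
-- supremum axiom and a one-sided Lipschitz bound.

open import Defs
open import Algebra.Bundles using (CommutativeRing; Semiring)
open import Algebra.Solver.Ring.AlmostCommutativeRing using (fromCommutativeRing; _-Raw-AlmostCommutative⟶_)
open import Data.Empty using (⊥; ⊥-elim)
open import Data.Fin.Base using (zero; suc)
open import Data.Integer.Base as ℤ using (ℤ; -[1+_]; _⊖_; _◃_)
open import Data.Integer.Properties as ℤ using ([1+m]⊖[1+n]≡m⊖n)
open import Data.List.Base using (List; []; _∷_; _++_; foldr; length; map)
open import Data.List.Properties using (length-++)
open import Data.List.Relation.Unary.All as All using (All; []; _∷_)
open import Data.List.Relation.Unary.All.Properties as All using (++⁺)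
open import Data.Maybe.Base as Maybe using ()
open import Data.Nat.Base as ℕ using (ℕ; zero; suc; z≤n; s≤s; _!) renaming (_≤_ to _≤ℕ_)
open import Data.Nat.Properties as ℕ using ()
open import Data.Product.Base using (∃-syntax; _×_; _,_; proj₁; proj₂)
open import Data.Sum.Base using (inj₁; inj₂; [_,_]′)
open import Data.Vec.Functional as Vector using (Vector)
open import Function.Base using (_∘_)
open import Relation.Binary.Definitions using (tri<; tri≈; tri>)
open import Relation.Binary.PropositionalEquality as ≡ using (_≡_)
open import Relation.Binary.Structures using (IsStrictTotalOrder)
open import Relation.Nullary.Decidable using (dec⇒maybe)
open import Relation.Nullary.Negation using (¬_)
import Algebra.Definitions.RawMonoid as RawMonoidDefinitions
import Algebra.Definitions.RawSemiring as RawSemiringDefinitions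
import Algebra.Properties.Semiring.Mult as SemiringMult
import Algebra.Solver.Ring as RingSolver
import Data.Sign.Base as Sign

-- Ring normalisation with integer constants

-- The ring solver over a commutative ring R, with coefficients in ℤ.  Equality in R need not
-- be decidable; cancellation of terms is recognised in ℤ.
module IntegerCoefficients {c ℓ} (R : CommutativeRing c ℓ) where

  open CommutativeRing R
  open import Algebra.Properties.Semiring.Mult.TCOptimised semiring using (1+×; ×-homo-+; ×1-homo-*) renaming (_×_ to _·_)
  open import Algebra.Properties.Ring ring using (-‿distribˡ-*; -‿distribʳ-*; -0#≈0#; -‿involutive; -‿+-comm)
  open import Relation.Binary.Reasoning.Setoid setoid

  -- The unique ring homomorphism ℤ → R.  The multiples n · 1# are those for which 1 · 1# is
  -- 1# itself, so that solver constants agree definitionally with 0#, 1# and - 1#.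
  fromℤ : ℤ → Carrier
  fromℤ (ℤ.+ n)  = n · 1#
  fromℤ -[1+ n ] = - (suc n · 1#)

  ⊖-homo : ∀ m n → fromℤ (m ⊖ n) ≈ m · 1# - n · 1#
  ⊖-homo m zero = begin
    m · 1#           ≈⟨ +-identityʳ _ ⟨
    m · 1# + 0#      ≈⟨ +-congˡ -0#≈0# ⟨
    m · 1# - 0#      ∎
  ⊖-homo zero    (suc n) = sym (+-identityˡ _)
  ⊖-homo (suc m) (suc n) = begin
    fromℤ (suc m ⊖ suc n)                ≡⟨ ≡.cong fromℤ ([1+m]⊖[1+n]≡m⊖n m n) ⟩
    fromℤ (m ⊖ n)                        ≈⟨ ⊖-homo m n ⟩
    m · 1# - n · 1#                      ≈⟨ +-congʳ (+-identityʳ _) ⟨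
    m · 1# + 0# - n · 1#                 ≈⟨ +-congʳ (+-congˡ (-‿inverseʳ 1#)) ⟨
    m · 1# + (1# - 1#) - n · 1#          ≈⟨ +-congʳ (+-assoc _ _ _) ⟨
    m · 1# + 1# - 1# - n · 1#            ≈⟨ +-assoc _ _ _ ⟩
    m · 1# + 1# + (- 1# - n · 1#)        ≈⟨ +-cong (+-comm _ _) (-‿+-comm _ _) ⟩
    1# + m · 1# - (1# + n · 1#)          ≈⟨ +-cong (1+× m 1#) (-‿cong (1+× n 1#)) ⟨
    suc m · 1# - suc n · 1#              ∎

  +-homo : ∀ i j → fromℤ (i ℤ.+ j) ≈ fromℤ i + fromℤ j
  +-homo (ℤ.+ m)  (ℤ.+ n)  = ×-homo-+ 1# m n
  +-homo (ℤ.+ m)  -[1+ n ] = ⊖-homo m (suc n)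
  +-homo -[1+ m ] (ℤ.+ n)  = trans (⊖-homo n (suc m)) (+-comm _ _)
  +-homo -[1+ m ] -[1+ n ] = begin
    - (suc (suc (m ℕ.+ n)) · 1#)         ≡⟨ ≡.cong (λ k → - (k · 1#)) (≡.cong suc (ℕ.+-suc m n)) ⟨
    - ((suc m ℕ.+ suc n) · 1#)           ≈⟨ -‿cong (×-homo-+ 1# (suc m) (suc n)) ⟩
    - (suc m · 1# + suc n · 1#)          ≈⟨ -‿+-comm _ _ ⟨
    - (suc m · 1#) - suc n · 1#          ∎

  -‿homo : ∀ i → fromℤ (ℤ.- i) ≈ - fromℤ i
  -‿homo (ℤ.+ zero)  = sym -0#≈0#
  -‿homo (ℤ.+ suc n) = refl
  -‿homo -[1+ n ]    = sym (-‿involutive _)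

  -◃-homo : ∀ n → fromℤ (Sign.- ◃ n) ≈ - (n · 1#)
  -◃-homo zero    = sym -0#≈0#
  -◃-homo (suc n) = refl

  +◃-homo : ∀ n → fromℤ (Sign.+ ◃ n) ≈ n · 1#
  +◃-homo zero    = refl
  +◃-homo (suc n) = refl

  *-homo : ∀ i j → fromℤ (i ℤ.* j) ≈ fromℤ i * fromℤ j
  *-homo (ℤ.+ m)  (ℤ.+ n)  = trans (+◃-homo (m ℕ.* n)) (×1-homo-* m n)
  *-homo (ℤ.+ m)  -[1+ n ] = begin
    fromℤ (Sign.- ◃ m ℕ.* suc n)         ≈⟨ -◃-homo (m ℕ.* suc n) ⟩
    - ((m ℕ.* suc n) · 1#)               ≈⟨ -‿cong (×1-homo-* m (suc n)) ⟩
    - (m · 1# * suc n · 1#)              ≈⟨ -‿distribʳ-* _ _ ⟩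
    m · 1# * - (suc n · 1#)              ∎
  *-homo -[1+ m ] (ℤ.+ n)  = begin
    fromℤ (Sign.- ◃ suc m ℕ.* n)         ≈⟨ -◃-homo (suc m ℕ.* n) ⟩
    - ((suc m ℕ.* n) · 1#)               ≈⟨ -‿cong (×1-homo-* (suc m) n) ⟩
    - (suc m · 1# * n · 1#)              ≈⟨ -‿distribˡ-* _ _ ⟩
    - (suc m · 1#) * n · 1#              ∎
  *-homo -[1+ m ] -[1+ n ] = begin
    (suc m ℕ.* suc n) · 1#               ≈⟨ ×1-homo-* (suc m) (suc n) ⟩
    suc m · 1# * suc n · 1#              ≈⟨ -‿involutive _ ⟨
    - - (suc m · 1# * suc n · 1#)        ≈⟨ -‿cong (-‿distribʳ-* _ _) ⟩
    - (suc m · 1# * - (suc n · 1#))      ≈⟨ -‿distribˡ-* _ _ ⟩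
    - (suc m · 1#) * - (suc n · 1#)      ∎

  fromℤ-morphism : ℤ.+-*-rawRing -Raw-AlmostCommutative⟶ fromCommutativeRing R
  fromℤ-morphism = record
    { ⟦_⟧ = fromℤ ; +-homo = +-homo ; *-homo = *-homo ; -‿homo = -‿homo ; 0-homo = refl ; 1-homo = refl }

  open RingSolver ℤ.+-*-rawRing (fromCommutativeRing R) fromℤ-morphism
    (λ i j → Maybe.map (λ eq → reflexive (≡.cong fromℤ eq)) (dec⇒maybe (i ℤ.≟ j))) public
    using (Polynomial; solve; _:=_; _:+_; _:*_; _:-_; :-_; con)

  -- Solver syntax for the constants 1# and 0#.
  :1 : ∀ {n} → Polynomial n
  :1 = con (ℤ.+ 1)

  :0 : ∀ {n} → Polynomial n
  :0 = con (ℤ.+ 0)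

-- Zeros of Jacobi–Piñeiro polynomials over a complete ordered field

module JacobiPiñeiroZeros (ℝ : CompleteOrderedField) where

  open JacobiPiñeiro ℝ
  open CommutativeRing commutativeRing
    using ( setoid; refl; sym; trans; reflexive; +-cong; +-congˡ; +-congʳ; *-cong; *-congˡ; *-congʳ; -‿cong
          ; +-identityˡ; +-identityʳ; *-identityˡ; *-identityʳ; *-assoc; *-comm; zeroˡ; zeroʳ)
  open IsStrictTotalOrder isStrictTotalOrder
    using (compare; irrefl; asym; <-respʳ-≈; <-respˡ-≈) renaming (trans to <-trans)
  open IntegerCoefficients commutativeRing
  open RawMonoidDefinitions *-rawMonoid using () renaming (sum to product)
  open RawSemiringDefinitions (Semiring.rawSemiring semiring) using (_^_)
  open SemiringMult semiring using (×1-homo-*)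
  open import Relation.Binary.Reasoning.Setoid setoid

  -- Ordered fields

  x<y⇒0<y-x : ∀ {x y} → x < y → 0# < y - x
  x<y⇒0<y-x {x} {y} x<y =
    <-respˡ-≈ (solve 1 (λ x → (:- x) :+ x := :0) refl x)
    (<-respʳ-≈ (solve 2 (λ x y → (:- x) :+ y := y :- x) refl x y) (+-monoʳ-< (- x) x<y))

  0<y-x⇒x<y : ∀ {x y} → 0# < y - x → x < y
  0<y-x⇒x<y {x} {y} 0<y-x =
    <-respˡ-≈ (solve 1 (λ x → x :+ :0 := x) refl x)
    (<-respʳ-≈ (solve 2 (λ x y → x :+ (y :- x) := y) refl x y) (+-monoʳ-< x 0<y-x))

  x<0⇒0<-x : ∀ {x} → x < 0# → 0# < - x
  x<0⇒0<-x {x} x<0 = <-respʳ-≈ (solve 1 (λ x → :0 :- x := :- x) refl x) (x<y⇒0<y-x x<0)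

  +-positive : ∀ {x y} → 0# < x → 0# < y → 0# < x + y
  +-positive {x} {y} 0<x 0<y =
    <-trans 0<x (<-respˡ-≈ (+-identityʳ x) (+-monoʳ-< x 0<y))

  0<x⇒¬0<-x : ∀ {x} → 0# < x → ¬ (0# < - x)
  0<x⇒¬0<-x {x} 0<x 0<-x =
    irrefl refl (<-respʳ-≈ (solve 1 (λ x → x :- x := :0) refl x) (+-positive 0<x 0<-x))

  0<x⇒x≉0 : ∀ {x} → 0# < x → ¬ (x ≈ 0#)
  0<x⇒x≉0 0<x x≈0 = irrefl (sym x≈0) 0<x

  0<1 : 0# < 1#
  0<1 with compare 0# 1#
  ... | tri< 0<1 _ _ = 0<1
  ... | tri≈ _ 0≈1 _ = ⊥-elim (0≉1 0≈1)
  ... | tri> _ _ 1<0 =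
    <-respʳ-≈ (solve 0 ((:- :1) :* (:- :1) := :1) refl) (*-positive (x<0⇒0<-x 1<0) (x<0⇒0<-x 1<0))

  *-positive-cancelʳ : ∀ {x y} → 0# < y → 0# < x * y → 0# < x
  *-positive-cancelʳ {x} {y} 0<y 0<xy with compare 0# x
  ... | tri< 0<x _ _ = 0<x
  ... | tri≈ _ 0≈x _ = ⊥-elim (irrefl (trans (sym (zeroˡ y)) (*-congʳ 0≈x)) 0<xy)
  ... | tri> _ _ x<0 = ⊥-elim (0<x⇒¬0<-x 0<xy
    (<-respʳ-≈ (solve 2 (λ x y → (:- x) :* y := :- (x :* y)) refl x y) (*-positive (x<0⇒0<-x x<0) 0<y)))

  ⁻¹-inverseˡ : ∀ {x} → ¬ (x ≈ 0#) → x ⁻¹ * x ≈ 1#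
  ⁻¹-inverseˡ x≉0 = trans (*-comm _ _) (⁻¹-inverseʳ x≉0)

  *-cancelˡ : ∀ {x y z} → ¬ (x ≈ 0#) → x * y ≈ x * z → y ≈ z
  *-cancelˡ {x} {y} {z} x≉0 xy≈xz = begin
    y               ≈⟨ undo y ⟨
    x ⁻¹ * (x * y)  ≈⟨ *-congˡ xy≈xz ⟩
    x ⁻¹ * (x * z)  ≈⟨ undo z ⟩
    z               ∎
    where
    undo : ∀ u → x ⁻¹ * (x * u) ≈ u
    undo u = trans (sym (*-assoc _ _ _)) (trans (*-congʳ (⁻¹-inverseˡ x≉0)) (*-identityˡ u))

  ⁻¹-positive : ∀ {x} → 0# < x → 0# < x ⁻¹
  ⁻¹-positive 0<x = *-positive-cancelʳ 0<x (<-respʳ-≈ (sym (⁻¹-inverseˡ (0<x⇒x≉0 0<x))) 0<1)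

  *-nonzero : ∀ {x y} → ¬ (x ≈ 0#) → ¬ (y ≈ 0#) → ¬ (x * y ≈ 0#)
  *-nonzero {x} {y} x≉0 y≉0 xy≈0 = x≉0 (begin
    x               ≈⟨ *-identityʳ x ⟨
    x * 1#          ≈⟨ *-congˡ (⁻¹-inverseʳ y≉0) ⟨
    x * (y * y ⁻¹)  ≈⟨ *-assoc _ _ _ ⟨
    x * y * y ⁻¹    ≈⟨ *-congʳ xy≈0 ⟩
    0# * y ⁻¹       ≈⟨ zeroˡ _ ⟩
    0#              ∎)

  0<x⇒-x≉0 : ∀ {x} → 0# < x → ¬ (- x ≈ 0#)
  0<x⇒-x≉0 {x} 0<x -x≈0 =
    0<x⇒x≉0 0<x (trans (solve 1 (λ x → x := :- (:- x)) refl x) (trans (-‿cong -x≈0) (solve 0 (:- :0 := :0) refl)))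

  0≤-resp-≈ : ∀ {x y} → x ≈ y → 0# ≤ x → 0# ≤ y
  0≤-resp-≈ x≈y (inj₁ 0<x) = inj₁ (<-respʳ-≈ x≈y 0<x)
  0≤-resp-≈ x≈y (inj₂ 0≈x) = inj₂ (trans 0≈x x≈y)

  +-pos-nonneg : ∀ {x y} → 0# < x → 0# ≤ y → 0# < x + y
  +-pos-nonneg 0<x (inj₁ 0<y) = +-positive 0<x 0<y
  +-pos-nonneg 0<x (inj₂ 0≈y) = <-respʳ-≈ (trans (sym (+-identityʳ _)) (+-congˡ 0≈y)) 0<x

  +-nonneg : ∀ {x y} → 0# ≤ x → 0# ≤ y → 0# ≤ x + y
  +-nonneg (inj₁ 0<x) 0≤y = inj₁ (+-pos-nonneg 0<x 0≤y)
  +-nonneg (inj₂ 0≈x) 0≤y = 0≤-resp-≈ (trans (sym (+-identityˡ _)) (+-congʳ 0≈x)) 0≤y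

  *-nonneg : ∀ {x y} → 0# ≤ x → 0# ≤ y → 0# ≤ x * y
  *-nonneg (inj₁ 0<x) (inj₁ 0<y) = inj₁ (*-positive 0<x 0<y)
  *-nonneg {x} {y} (inj₁ _) (inj₂ 0≈y) = inj₂ (trans (sym (zeroʳ x)) (*-congˡ 0≈y))
  *-nonneg {x} {y} (inj₂ 0≈x) _ = inj₂ (trans (sym (zeroˡ y)) (*-congʳ 0≈x))

  x≤y⇒0≤y-x : ∀ {x y} → x ≤ y → 0# ≤ y - x
  x≤y⇒0≤y-x (inj₁ x<y) = inj₁ (x<y⇒0<y-x x<y)
  x≤y⇒0≤y-x {x} {y} (inj₂ x≈y) =
    inj₂ (trans (solve 1 (λ x → :0 := x :- x) refl x) (+-congʳ x≈y))

  0≤y-x⇒x≤y : ∀ {x y} → 0# ≤ y - x → x ≤ y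
  0≤y-x⇒x≤y (inj₁ p) = inj₁ (0<y-x⇒x<y p)
  0≤y-x⇒x≤y {x} {y} (inj₂ p) = inj₂ (begin
    x            ≈⟨ +-identityʳ x ⟨
    x + 0#       ≈⟨ +-congˡ p ⟩
    x + (y - x)  ≈⟨ solve 2 (λ x y → x :+ (y :- x) := y) refl x y ⟩
    y            ∎)

  <-≤-absurd : ∀ {x y} → x < y → ¬ (y ≤ x)
  <-≤-absurd x<y (inj₁ y<x) = asym x<y y<x
  <-≤-absurd x<y (inj₂ y≈x) = irrefl (sym y≈x) x<y

  fromℕ-nonneg : ∀ m → 0# ≤ fromℕ m
  fromℕ-nonneg zero    = inj₂ refl
  fromℕ-nonneg (suc m) = inj₁ (+-pos-nonneg 0<1 (fromℕ-nonneg m))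

  fromℕ-positive : ∀ m → 0# < fromℕ (suc m)
  fromℕ-positive m = +-pos-nonneg 0<1 (fromℕ-nonneg m)

  -- The intermediate value theorem

  -- F grows at most at a linear rate on [0, M]: F x - F y ≤ L (x - y) for 0 ≤ y ≤ x ≤ M.
  -- This one-sided bound suffices for intermediate values where F passes from negative
  -- to positive.
  LipschitzAbove : Carrier → (Carrier → Carrier) → Set
  LipschitzAbove M F = ∃[ L ] 0# ≤ L ×
    (∀ {x y} → 0# ≤ y → 0# ≤ x - y → 0# ≤ M - x → 0# ≤ L * (x - y) - (F x - F y))

  -- The zero found is the supremum s of the points of [a, b] at which F is negative.
  module _ (F : Carrier → Carrier) (F-cong : ∀ {x y} → x ≈ y → F x ≈ F y)
           {a b : Carrier} (0≤a : 0# ≤ a) (a<b : a < b) (lipschitz : LipschitzAbove b F)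
           (0<-Fa : 0# < - F a) (0<Fb : 0# < F b) where
    private
      K : Carrier
      K = proj₁ lipschitz + 1#

      0<K : 0# < K
      0<K = <-respʳ-≈ (solve 1 (λ l → :1 :+ l := l :+ :1) refl _) (+-pos-nonneg 0<1 (proj₁ (proj₂ lipschitz)))

      -- Replacing L by K = L + 1 makes the Lipschitz inequality strict off the diagonal.
      strict : ∀ {x y} → 0# ≤ y → y < x → x ≤ b → 0# < K * (x - y) - (F x - F y)
      strict {x} {y} 0≤y y<x x≤b = <-respʳ-≈
        (solve 5 (λ l x y u v → (x :- y) :+ (l :* (x :- y) :- (u :- v)) := (l :+ :1) :* (x :- y) :- (u :- v)) refl
          (proj₁ lipschitz) x y (F x) (F y))
        (+-pos-nonneg (x<y⇒0<y-x y<x)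
          (proj₂ (proj₂ lipschitz) 0≤y (inj₁ (x<y⇒0<y-x y<x)) (x≤y⇒0≤y-x x≤b)))

      Negative : Carrier → Set
      Negative x = (a ≤ x) × (x ≤ b) × (0# < - F x)

      sup = supremum Negative (a , inj₂ refl , inj₁ a<b , 0<-Fa) (b , λ S → proj₁ (proj₂ S))

      s : Carrier
      s = proj₁ sup

      s-upper : ∀ {x} → Negative x → x ≤ s
      s-upper = proj₁ (proj₂ sup)

      s-least : ∀ {u} → (∀ {x} → Negative x → x ≤ u) → s ≤ u
      s-least = proj₂ (proj₂ sup)

      a≤s : a ≤ s
      a≤s = s-upper (inj₂ refl , inj₁ a<b , 0<-Fa)

      s≤b : s ≤ b
      s≤b = s-least (λ S → proj₁ (proj₂ S))

      ≤-nonneg : ∀ {x y} → 0# ≤ x → x ≤ y → 0# ≤ y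
      ≤-nonneg {x} {y} 0≤x x≤y =
        0≤-resp-≈ (solve 2 (λ x y → x :+ (y :- x) := y) refl x y) (+-nonneg 0≤x (x≤y⇒0≤y-x x≤y))

      -- From a point with |F| = v, the sign of F cannot change from negative to positive
      -- within distance v / K.
      δ : Carrier → Carrier
      δ v = v * K ⁻¹

      K*δ : ∀ v → K * δ v ≈ v
      K*δ v = begin
        K * (v * K ⁻¹)  ≈⟨ solve 3 (λ k v i → k :* (v :* i) := v :* (k :* i)) refl K v (K ⁻¹) ⟩
        v * (K * K ⁻¹)  ≈⟨ *-congˡ (⁻¹-inverseʳ (0<x⇒x≉0 0<K)) ⟩
        v * 1#          ≈⟨ *-identityʳ v ⟩
        v               ∎

      0<δ : ∀ {v} → 0# < v → 0# < δ v
      0<δ 0<v = *-positive 0<v (⁻¹-positive 0<K)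

      -- If F s < 0, then F is still negative at s + δ (- F s), or at b if b comes earlier.
      ¬Fs<0 : ¬ (0# < - F s)
      ¬Fs<0 0<-Fs = absurd
        where
        x = s + δ (- F s)

        s<x : s < x
        s<x = <-respˡ-≈ (+-identityʳ s) (+-monoʳ-< s (0<δ 0<-Fs))

        s<b : s < b
        s<b with s≤b
        ... | inj₁ s<b = s<b
        ... | inj₂ s≈b = ⊥-elim (0<x⇒¬0<-x 0<Fb (<-respʳ-≈ (-‿cong (F-cong s≈b)) 0<-Fs))

        K[x-s] : K * (x - s) ≈ - F s
        K[x-s] = trans (*-congˡ (solve 2 (λ s d → s :+ d :- s := d) refl s (δ (- F s)))) (K*δ (- F s))

        a<x : a < x
        a<x = [ (λ a<s → <-trans a<s s<x) , (λ a≈s → <-respˡ-≈ (sym a≈s) s<x) ]′ a≤s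

        x≰b : ¬ (x ≤ b)
        x≰b x≤b = <-≤-absurd s<x (s-upper (inj₁ a<x , x≤b , <-respʳ-≈ (begin
          K * (x - s) - (F x - F s)  ≈⟨ +-congʳ K[x-s] ⟩
          - F s - (F x - F s)        ≈⟨ solve 2 (λ u v → (:- u) :- (v :- u) := :- v) refl (F s) (F x) ⟩
          - F x                      ∎) (strict (≤-nonneg 0≤a a≤s) s<x x≤b)))

        absurd : ⊥
        absurd with compare x b
        ... | tri< x<b _ _ = x≰b (inj₁ x<b)
        ... | tri≈ _ x≈b _ = x≰b (inj₂ x≈b)
        ... | tri> _ _ b<x = 0<x⇒¬0<-x 0<Fb (<-respʳ-≈ (begin
            K * (x - b) + (K * (b - s) - (F b - F s))
              ≈⟨ solve 6 (λ k x b s u v → k :* (x :- b) :+ (k :* (b :- s) :- (u :- v)) := k :* (x :- s) :- (u :- v))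
                   refl K x b s (F b) (F s) ⟩
            K * (x - s) - (F b - F s)  ≈⟨ +-congʳ K[x-s] ⟩
            - F s - (F b - F s)        ≈⟨ solve 2 (λ u v → (:- u) :- (v :- u) := :- v) refl (F s) (F b) ⟩
            - F b                      ∎)
          (+-positive (*-positive 0<K (x<y⇒0<y-x b<x)) (strict (≤-nonneg 0≤a a≤s) s<b (inj₂ refl))))

      -- If 0 < F s, then s - δ (F s) is a smaller upper bound.
      ¬0<Fs : ¬ (0# < F s)
      ¬0<Fs 0<Fs = <-≤-absurd u<s (s-least u-upper)
        where
        u = s - δ (F s)

        u<s : u < s
        u<s = 0<y-x⇒x<y (<-respʳ-≈ (solve 2 (λ s d → d := s :- (s :- d)) refl s (δ (F s))) (0<δ 0<Fs))

        u-upper : ∀ {x} → Negative x → x ≤ u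
        u-upper {x} S@(a≤x , x≤b , 0<-Fx) with compare x u
        ... | tri< x<u _ _ = inj₁ x<u
        ... | tri≈ _ x≈u _ = inj₂ x≈u
        ... | tri> _ _ u<x with s-upper S
        ...   | inj₂ x≈s = ⊥-elim (0<x⇒¬0<-x 0<Fs (<-respʳ-≈ (-‿cong (F-cong x≈s)) 0<-Fx))
        ...   | inj₁ x<s = ⊥-elim (0<x⇒¬0<-x (<-respʳ-≈ (begin
            K * (x - u) + (K * (s - x) - (F s - F x))
              ≈⟨ solve 6 (λ k x d s v w → k :* (x :- (s :- d)) :+ (k :* (s :- x) :- (v :- w)) := k :* d :- (v :- w))
                   refl K x (δ (F s)) s (F s) (F x) ⟩
            K * δ (F s) - (F s - F x)  ≈⟨ +-congʳ (K*δ (F s)) ⟩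
            F s - (F s - F x)          ≈⟨ solve 2 (λ v w → v :- (v :- w) := w) refl (F s) (F x) ⟩
            F x                        ∎)
          (+-positive (*-positive 0<K (x<y⇒0<y-x u<x)) (strict (≤-nonneg 0≤a a≤x) x<s s≤b))) 0<-Fx)

      Fs≈0 : F s ≈ 0#
      Fs≈0 with compare 0# (F s)
      ... | tri< 0<Fs _ _ = ⊥-elim (¬0<Fs 0<Fs)
      ... | tri≈ _ 0≈Fs _ = sym 0≈Fs
      ... | tri> _ _ Fs<0 = ⊥-elim (¬Fs<0 (x<0⇒0<-x Fs<0))

    intermediateValue : ∃[ w ] a < w × w < b × F w ≈ 0#
    intermediateValue = s , a<s a≤s , s<b s≤b , Fs≈0
      where
      a<s : a ≤ s → a < s
      a<s (inj₁ a<s) = a<s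
      a<s (inj₂ a≈s) = ⊥-elim (0<x⇒-x≉0 (<-respʳ-≈ (-‿cong (F-cong a≈s)) 0<-Fa)
        (trans (solve 1 (λ x → :- (:- x) := x) refl (F s)) Fs≈0))

      s<b : s ≤ b → s < b
      s<b (inj₁ s<b) = s<b
      s<b (inj₂ s≈b) = ⊥-elim (0<x⇒x≉0 0<Fb (trans (F-cong (sym s≈b)) Fs≈0))

  -- Polynomials as finite power series

  Series : Set
  Series = PowerSeries Carrier

  -- Coefficientwise equality.
  infix 4 _≋_
  _≋_ : Series → Series → Set
  f ≋ g = ∀ k → f k ≈ g k

  -- The series (f - f 0) / x.
  tail : Series → Series
  tail f k = f (suc k)

  -- The series x f.
  shift : Series → Series
  shift f zero    = 0#
  shift f (suc k) = f k

  -- The value at x of the truncation of f to degree at most d, by Horner's rule.  For a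
  -- polynomial, any degree bound d gives its value (eval-stable).
  eval : ℕ → Series → Carrier → Carrier
  eval zero    f x = f 0
  eval (suc d) f x = f 0 + x * eval d (tail f) x

  Degree≤ : ℕ → Series → Set
  Degree≤ d f = ∀ {k} → d ℕ.< k → f k ≈ 0#

  eval-cong : ∀ d {f g x y} → f ≋ g → x ≈ y → eval d f x ≈ eval d g y
  eval-cong zero    f≋g x≈y = f≋g 0
  eval-cong (suc d) f≋g x≈y = +-cong (f≋g 0) (*-cong x≈y (eval-cong d (f≋g ∘ suc) x≈y))

  eval-stable : ∀ d {f} x → Degree≤ d f → eval (suc d) f x ≈ eval d f x
  eval-stable zero {f} x deg = begin
    f 0 + x * f 1  ≈⟨ +-congˡ (*-congˡ (deg (s≤s z≤n))) ⟩
    f 0 + x * 0#   ≈⟨ solve 2 (λ u x → u :+ x :* :0 := u) refl (f 0) x ⟩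
    f 0            ∎
  eval-stable (suc d) x deg = +-congˡ (*-congˡ (eval-stable d x (λ d<k → deg (s≤s d<k))))

  eval-minus : ∀ d f g x → eval d (λ k → f k - g k) x ≈ eval d f x - eval d g x
  eval-minus zero    f g x = refl
  eval-minus (suc d) f g x = begin
    f 0 - g 0 + x * eval d (λ k → tail f k - tail g k) x  ≈⟨ +-congˡ (*-congˡ (eval-minus d (tail f) (tail g) x)) ⟩
    f 0 - g 0 + x * (eval d (tail f) x - eval d (tail g) x)
      ≈⟨ solve 5 (λ a b x u v → a :- b :+ x :* (u :- v) := (a :+ x :* u) :- (b :+ x :* v)) refl
           (f 0) (g 0) x (eval d (tail f) x) (eval d (tail g) x) ⟩
    f 0 + x * eval d (tail f) x - (g 0 + x * eval d (tail g) x)  ∎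

  eval-* : ∀ d c f x → eval d (λ k → c * f k) x ≈ c * eval d f x
  eval-* zero    c f x = refl
  eval-* (suc d) c f x = begin
    c * f 0 + x * eval d (λ k → c * tail f k) x  ≈⟨ +-congˡ (*-congˡ (eval-* d c (tail f) x)) ⟩
    c * f 0 + x * (c * eval d (tail f) x)
      ≈⟨ solve 4 (λ c a x u → c :* a :+ x :* (c :* u) := c :* (a :+ x :* u)) refl c (f 0) x (eval d (tail f) x) ⟩
    c * (f 0 + x * eval d (tail f) x)            ∎

  eval-neg : ∀ d f x → eval d (λ k → - f k) x ≈ - eval d f x
  eval-neg zero    f x = refl
  eval-neg (suc d) f x = begin
    - f 0 + x * eval d (λ k → - tail f k) x  ≈⟨ +-congˡ (*-congˡ (eval-neg d (tail f) x)) ⟩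
    - f 0 + x * - eval d (tail f) x
      ≈⟨ solve 3 (λ a x u → (:- a) :+ x :* (:- u) := :- (a :+ x :* u)) refl (f 0) x (eval d (tail f) x) ⟩
    - (f 0 + x * eval d (tail f) x)          ∎

  eval-0 : ∀ d f → eval d f 0# ≈ f 0
  eval-0 zero    f = refl
  eval-0 (suc d) f = solve 2 (λ a u → a :+ :0 :* u := a) refl (f 0) (eval d (tail f) 0#)

  -- The product (x - w) f.
  mulLinear : Carrier → Series → Series
  mulLinear w f k = shift f k - w * f k

  eval-shift : ∀ d f x → eval (suc d) (shift f) x ≈ x * eval d f x
  eval-shift d f x = +-identityˡ _

  eval-mulLinear : ∀ d w {f} x → Degree≤ d f → eval (suc d) (mulLinear w f) x ≈ (x - w) * eval d f x
  eval-mulLinear d w {f} x deg = begin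
    eval (suc d) (mulLinear w f) x
      ≈⟨ eval-minus (suc d) (shift f) (λ k → w * f k) x ⟩
    eval (suc d) (shift f) x - eval (suc d) (λ k → w * f k) x
      ≈⟨ +-cong (eval-shift d f x) (-‿cong (trans (eval-* (suc d) w f x) (*-congˡ (eval-stable d x deg)))) ⟩
    x * eval d f x - w * eval d f x
      ≈⟨ solve 3 (λ x w u → x :* u :- w :* u := (x :- w) :* u) refl x w (eval d f x) ⟩
    (x - w) * eval d f x
      ∎

  shift-cong : ∀ {f g} → f ≋ g → shift f ≋ shift g
  shift-cong f≋g zero    = refl
  shift-cong f≋g (suc k) = f≋g k

  mulLinear-cong : ∀ w {f g} → f ≋ g → mulLinear w f ≋ mulLinear w g
  mulLinear-cong w f≋g k = +-cong (shift-cong f≋g k) (-‿cong (*-congˡ (f≋g k)))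

  mulLinear-comm : ∀ v w f → mulLinear v (mulLinear w f) ≋ mulLinear w (mulLinear v f)
  mulLinear-comm v w f zero = solve 3 (λ v w a → :0 :- v :* (:0 :- w :* a) := :0 :- w :* (:0 :- v :* a)) refl v w (f 0)
  mulLinear-comm v w f (suc k) =
    solve 5 (λ v w a b c → (a :- w :* b) :- v :* (b :- w :* c) := (a :- v :* b) :- w :* (b :- v :* c)) refl
      v w (shift f k) (f k) (f (suc k))

  mulLinear-scale : ∀ w c f → mulLinear w (λ k → c * f k) ≋ (λ k → c * mulLinear w f k)
  mulLinear-scale w c f zero    = solve 3 (λ w c a → :0 :- w :* (c :* a) := c :* (:0 :- w :* a)) refl w c (f 0)
  mulLinear-scale w c f (suc k) =
    solve 4 (λ w c a b → c :* a :- w :* (c :* b) := c :* (a :- w :* b)) refl w c (f k) (f (suc k))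

  -- The form in which coefficients of mulLinear vanish.
  -‿zero : ∀ {x y} w → x ≈ 0# → y ≈ 0# → x - w * y ≈ 0#
  -‿zero {x} {y} w x≈0 y≈0 =
    trans (+-cong x≈0 (-‿cong (*-congˡ y≈0))) (solve 1 (λ w → :0 :- w :* :0 := :0) refl w)

  mulLinear-degree : ∀ d w {f} → Degree≤ d f → Degree≤ (suc d) (mulLinear w f)
  mulLinear-degree d w deg (s≤s d<k) = -‿zero w (deg d<k) (deg (ℕ.m≤n⇒m≤1+n d<k))

  mulLinear-leading : ∀ d w {f} → Degree≤ d f → mulLinear w f (suc d) ≈ f d
  mulLinear-leading d w {f} deg = begin
    f d - w * f (suc d)  ≈⟨ +-congˡ (-‿cong (*-congˡ (deg (ℕ.n<1+n d)))) ⟩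
    f d - w * 0#         ≈⟨ solve 2 (λ a w → a :- w :* :0 := a) refl (f d) w ⟩
    f d                  ∎

  -- The quotient of f, of degree at most d, on division by x - w (Ruffini–Horner).  From
  -- f = f 0 + x (tail f) one gets
  --   f(x) - f(w) = (x - w) (tail f)(w) + x ((tail f)(x) - (tail f)(w)),
  -- which is the recursion on d.
  quotient : ℕ → Series → Carrier → Series
  quotient zero    f w k       = 0#
  quotient (suc d) f w zero    = eval d (tail f) w
  quotient (suc d) f w (suc k) = quotient d (tail f) w k

  quotient-degree : ∀ d f w → ∀ {k} → d ℕ.≤ k → quotient d f w k ≈ 0#
  quotient-degree zero    f w _         = refl
  quotient-degree (suc d) f w (s≤s d≤k) = quotient-degree d (tail f) w d≤k

  quotient-constant : ∀ d f w → f 0 ≈ eval d f w - w * quotient d f w 0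
  quotient-constant zero    f w = solve 2 (λ a w → a := a :- w :* :0) refl (f 0) w
  quotient-constant (suc d) f w = solve 3 (λ a w u → a := a :+ w :* u :- w :* u) refl (f 0) w (eval d (tail f) w)

  quotient-coefficient : ∀ d f w → Degree≤ d f → ∀ k → tail f k ≈ mulLinear w (quotient d f w) (suc k)
  quotient-coefficient zero f w deg k = trans (deg (s≤s z≤n)) (sym (-‿zero w refl refl))
  quotient-coefficient (suc d) f w deg zero    = quotient-constant d (tail f) w
  quotient-coefficient (suc d) f w deg (suc k) = quotient-coefficient d (tail f) w (λ d<k → deg (s≤s d<k)) k

  factor : ∀ d {f w} → Degree≤ d f → eval d f w ≈ 0# → f ≋ mulLinear w (quotient d f w)
  factor d {f} {w} deg root zero    = trans (quotient-constant d f w) (+-congʳ root)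
  factor d {f} {w} deg root (suc k) = quotient-coefficient d f w deg k

  -- This bound and the Lipschitz constant below follow Horner's rule; for the latter,
  -- x u - y v = x (u - v) + (x - y) v with u and v the values of tail f at x and y.
  boundedAbove : ∀ d f {M} → 0# ≤ M → ∃[ B ] 0# ≤ B × (∀ {x} → 0# ≤ x → 0# ≤ M - x → 0# ≤ B - eval d f x)
  boundedAbove zero f 0≤M with compare 0# (f 0)
  ... | tri< 0<f₀ _ _ = f 0 , inj₁ 0<f₀ , λ _ _ → inj₂ (solve 1 (λ a → :0 := a :- a) refl (f 0))
  ... | tri≈ _ 0≈f₀ _ = f 0 , inj₂ 0≈f₀ , λ _ _ → inj₂ (solve 1 (λ a → :0 := a :- a) refl (f 0))
  ... | tri> _ _ f₀<0 = 0# , inj₂ refl , λ _ _ → inj₁ (x<y⇒0<y-x f₀<0)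
  boundedAbove (suc d) f {M} 0≤M with boundedAbove zero f 0≤M | boundedAbove d (tail f) 0≤M
  ... | B , 0≤B , bound | B′ , 0≤B′ , bound′ =
    B + M * B′ , +-nonneg 0≤B (*-nonneg 0≤M 0≤B′) , λ {x} 0≤x 0≤M-x →
      0≤-resp-≈
        (solve 6 (λ b a x m b′ u → (b :- a) :+ (x :* (b′ :- u) :+ (m :- x) :* b′) := (b :+ m :* b′) :- (a :+ x :* u)) refl
          B (f 0) x M B′ (eval d (tail f) x))
        (+-nonneg (bound 0≤x 0≤M-x) (+-nonneg (*-nonneg 0≤x (bound′ 0≤x 0≤M-x)) (*-nonneg 0≤M-x 0≤B′)))

  eval-lipschitz : ∀ d f {M} → 0# ≤ M → LipschitzAbove M (eval d f)
  eval-lipschitz zero f 0≤M = 0# , inj₂ refl , λ {x} {y} _ _ _ →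
    inj₂ (solve 3 (λ x y a → :0 := :0 :* (x :- y) :- (a :- a)) refl x y (f 0))
  eval-lipschitz (suc d) f {M} 0≤M with boundedAbove d (tail f) 0≤M | eval-lipschitz d (tail f) 0≤M
  ... | B , 0≤B , bound | L , 0≤L , lipschitz =
    M * L + B , +-nonneg (*-nonneg 0≤M 0≤L) 0≤B , λ {x} {y} 0≤y 0≤x-y 0≤M-x →
      0≤-resp-≈
        (solve 8 (λ a x y m b l u v →
            x :* (l :* (x :- y) :- (u :- v)) :+ ((m :- x) :* (l :* (x :- y)) :+ (x :- y) :* (b :- v))
              := (m :* l :+ b) :* (x :- y) :- ((a :+ x :* u) :- (a :+ y :* v))) refl
          (f 0) x y M B L (eval d (tail f) x) (eval d (tail f) y))
        (+-nonneg
          (*-nonneg (0≤-resp-≈ (solve 2 (λ x y → y :+ (x :- y) := x) refl x y) (+-nonneg 0≤y 0≤x-y))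
                    (lipschitz 0≤y 0≤x-y 0≤M-x))
          (+-nonneg
            (*-nonneg 0≤M-x (*-nonneg 0≤L 0≤x-y))
            (*-nonneg 0≤x-y
              (bound 0≤y (0≤-resp-≈ (solve 3 (λ m x y → (m :- x) :+ (x :- y) := m :- y) refl M x y) (+-nonneg 0≤M-x 0≤x-y))))))

  -- Sign alternation and splitting off zeros

  -- t > z₁ > z₂ > ... > zₘ > 0 for the list z₁, ..., zₘ.
  Descending : Carrier → List Carrier → Set
  Descending t []       = 0# < t
  Descending t (z ∷ zs) = z < t × Descending z zs

  -- At the points t₁, ..., tₘ, 0, where t₁, ..., tₘ is the list, the values of F are
  -- positive, negative, positive, and so on.  The final point 0 is not listed.
  Alternating : (Carrier → Carrier) → List Carrier → Set
  Alternating F []       = 0# < F 0#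
  Alternating F (t ∷ ts) = 0# < F t × Alternating (λ x → - F x) ts

  descending-positive : ∀ {t} zs → Descending t zs → 0# < t
  descending-positive []       0<t         = 0<t
  descending-positive (z ∷ zs) (z<t , zs↓) = <-trans (descending-positive zs zs↓) z<t

  descending-all : ∀ {t} zs → Descending t zs → All (λ z → 0# < z × z < t) zs
  descending-all []       _           = []
  descending-all (z ∷ zs) (z<t , zs↓) =
    (descending-positive zs zs↓ , z<t) ∷
    All.map (λ { (0<x , x<z) → 0<x , <-trans x<z z<t }) (descending-all zs zs↓)

  -- At x, if F is positive so is G, and if F is negative so is G.
  SameSign : (F G : Carrier → Carrier) → Carrier → Set
  SameSign F G x = (0# < F x → 0# < G x) × (0# < - F x → 0# < - G x)

  sameSign-negate : ∀ {F G x} → SameSign F G x → SameSign (λ x → - F x) (λ x → - G x) x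
  sameSign-negate (pos , neg) = neg ,
    <-respʳ-≈ (solve 1 (λ u → u := :- (:- u)) refl _) ∘ pos ∘ <-respʳ-≈ (solve 1 (λ u → :- (:- u) := u) refl _)

  sameSign-≈ : ∀ {F G x} → F x ≈ G x → SameSign F G x
  sameSign-≈ Fx≈Gx = <-respʳ-≈ Fx≈Gx , <-respʳ-≈ (-‿cong Fx≈Gx)

  sameSign-multiply : ∀ {F G x p} → 0# < p → F x * p ≈ G x → SameSign F G x
  sameSign-multiply {F} {G} {x} {p} 0<p Fp≈G =
    (λ 0<F → <-respʳ-≈ Fp≈G (*-positive 0<F 0<p)) ,
    (λ 0<-F → <-respʳ-≈ (trans (solve 2 (λ u p → (:- u) :* p := :- (u :* p)) refl (F x) p) (-‿cong Fp≈G)) (*-positive 0<-F 0<p))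

  sameSign-divide : ∀ {F G x p} → 0# < p → F x ≈ G x * p → SameSign F G x
  sameSign-divide {F} {G} {x} {p} 0<p F≈Gp =
    (λ 0<F → *-positive-cancelʳ 0<p (<-respʳ-≈ F≈Gp 0<F)) ,
    (λ 0<-F → *-positive-cancelʳ 0<p
      (<-respʳ-≈ (trans (-‿cong F≈Gp) (solve 2 (λ u p → :- (u :* p) := (:- u) :* p) refl (G x) p)) 0<-F))

  alternating-transport : ∀ {F G} ts → All (SameSign F G) ts → SameSign F G 0# → Alternating F ts → Alternating G ts
  alternating-transport []       []       F~G₀ 0<F₀       = proj₁ F~G₀ 0<F₀
  alternating-transport {F} {G} (t ∷ ts) (F~G ∷ F~Gs) F~G₀ (0<F , alt) =
    proj₁ F~G 0<F ,
    alternating-transport ts (All.map (sameSign-negate {F} {G}) F~Gs) (sameSign-negate {F} {G} F~G₀) alt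

  -- The first point y of the sequence ts, 0, which is the left end of the interval searched
  -- for a zero; any w above y may stand in for t as upper bound of ts.
  nextPoint : ∀ {F t} ts → Descending t ts → Alternating F ts →
              ∃[ y ] 0# ≤ y × y < t × 0# < F y × (∀ {w} → y < w → Descending w ts)
  nextPoint []       0<t         0<F₀    = 0# , inj₂ refl , 0<t , 0<F₀ , λ 0<w → 0<w
  nextPoint (z ∷ zs) (z<t , zs↓) (0<F , _) = z , inj₁ (descending-positive zs zs↓) , z<t , 0<F , λ z<w → z<w , zs↓

  -- The factorisation of f as (x - root) g, where g has degree at most d and alternates
  -- in sign on the remaining points, all of which lie below the root.
  record Peeled (d : ℕ) (f : Series) (t : Carrier) (ts : List Carrier) : Set where
    field
      root         : Carrier
      cofactor     : Series
      root<t       : root < t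
      descending   : Descending root ts
      degree       : Degree≤ d cofactor
      alternating  : Alternating (eval d cofactor) ts
      factorised   : f ≋ mulLinear root cofactor

  -- If f is positive at t, negative at the next point, and alternates from there on, it has
  -- a zero w between these two points.  Below w the factor x - w is negative, so dividing by
  -- it turns the pattern -, +, -, ... into +, -, +, ....
  peel : ∀ d {f t} ts → Degree≤ (suc d) f → Descending t ts → 0# < eval (suc d) f t →
         Alternating (λ x → - eval (suc d) f x) ts → Peeled d f t ts
  peel d {f} {t} ts deg ts↓ 0<ft alt = fromNextPoint (nextPoint ts ts↓ alt)
    where
    fromRoot : ∃[ w ] Descending w ts × w < t × eval (suc d) f w ≈ 0# → Peeled d f t ts
    fromRoot (w , w↓ , w<t , fw≈0) = record
      { root = w ; cofactor = g ; root<t = w<t ; descending = w↓ ; degree = g-degree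
      ; alternating = alternating-transport ts (All.map (λ { (_ , x<w) → same x<w }) (descending-all ts w↓))
          (same (descending-positive ts w↓)) alt
      ; factorised = f≋ }
      where
      g : Series
      g = quotient (suc d) f w

      g-degree : Degree≤ d g
      g-degree = quotient-degree (suc d) f w

      f≋ : f ≋ mulLinear w g
      f≋ = factor (suc d) deg fw≈0

      same : ∀ {x} → x < w → SameSign (λ x → - eval (suc d) f x) (eval d g) x
      same {x} x<w = sameSign-divide {λ x → - eval (suc d) f x} {eval d g} (x<y⇒0<y-x x<w) (begin
        - eval (suc d) f x                  ≈⟨ -‿cong (eval-cong (suc d) f≋ refl) ⟩
        - eval (suc d) (mulLinear w g) x    ≈⟨ -‿cong (eval-mulLinear d w x g-degree) ⟩
        - ((x - w) * eval d g x)            ≈⟨ solve 3 (λ x w u → :- ((x :- w) :* u) := u :* (w :- x)) refl x w (eval d g x) ⟩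
        eval d g x * (w - x)                ∎)

    fromNextPoint : ∃[ y ] 0# ≤ y × y < t × 0# < - eval (suc d) f y × (∀ {w} → y < w → Descending w ts) → Peeled d f t ts
    fromNextPoint (y , 0≤y , y<t , 0<-fy , ↓-from-y) = fromRoot (w , ↓-from-y {w} y<w , w<t , fw≈0)
      where
      ivt : ∃[ w ] y < w × w < t × eval (suc d) f w ≈ 0#
      ivt = intermediateValue (eval (suc d) f) (eval-cong (suc d) {f} {f} (λ _ → refl)) 0≤y y<t
              (eval-lipschitz (suc d) f (inj₁ (descending-positive ts ts↓))) 0<-fy 0<ft
      w    = proj₁ ivt
      y<w  = proj₁ (proj₂ ivt)
      w<t  = proj₁ (proj₂ (proj₂ ivt))
      fw≈0 = proj₂ (proj₂ (proj₂ ivt))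

  -- The constant polynomial 1.
  one : Series
  one zero    = 1#
  one (suc k) = 0#

  -- The product of g with the linear factors x - w, for w in ws.
  infixr 5 _⟨*⟩_
  _⟨*⟩_ : List Carrier → Series → Series
  ws ⟨*⟩ g = foldr mulLinear g ws

  -- The monic polynomial with the given list of zeros.
  ∏ : List Carrier → Series
  ∏ ws = ws ⟨*⟩ one

  -- The result of splitting off m zeros below w from a polynomial f of degree at most d; the
  -- cofactor has degree at most e.  The last three fields make the cofactor a positive
  -- constant when e = 0, and serve to locate its zero when e = 1.
  record Extracted (e d : ℕ) (f : Series) (w : Carrier) (m : ℕ) : Set where
    field
      roots          : List Carrier
      cofactor       : Series
      count          : length roots ≡ m
      descending     : Descending w roots
      degree         : Degree≤ e cofactor
      factorised     : f ≋ roots ⟨*⟩ cofactor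
      positive-at-0  : 0# < cofactor 0
      leading        : cofactor e ≈ f d
      nonneg-at-1    : w ≤ 1# → 0# ≤ eval d f 1# → 0# ≤ eval e cofactor 1#

  extract : ∀ e d ts {f w} → d ≡ length ts ℕ.+ e → Degree≤ d f → Descending w ts → Alternating (eval d f) ts →
            Extracted e d f w (length ts)
  extract e d [] {f} ≡.refl deg 0<w 0<f₀ = record
    { roots = [] ; cofactor = f ; count = ≡.refl ; descending = 0<w ; degree = deg ; factorised = λ _ → refl
    ; positive-at-0 = <-respʳ-≈ (eval-0 d f) 0<f₀ ; leading = refl ; nonneg-at-1 = λ _ p → p }
  extract e (suc d) (t ∷ ts) {f} {w} ≡.refl deg (t<w , ts↓) (0<ft , alt) = record
    { roots = v ∷ E.roots ; cofactor = E.cofactor ; count = ≡.cong suc E.count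
    ; descending = <-trans v<t t<w , E.descending ; degree = E.degree
    ; factorised = λ k → trans (P.factorised k) (mulLinear-cong v E.factorised k)
    ; positive-at-0 = E.positive-at-0
    ; leading = trans E.leading (sym (trans (P.factorised (suc d)) (mulLinear-leading d v P.degree)))
    ; nonneg-at-1 = λ w≤1 0≤f1 → E.nonneg-at-1 (inj₁ (v<1 w≤1)) (0≤g1 w≤1 0≤f1) }
    where
    module P = Peeled (peel d ts deg ts↓ 0<ft alt)
    v = P.root
    v<t = P.root<t
    module E = Extracted (extract e d ts ≡.refl P.degree P.descending P.alternating)

    v<1 : w ≤ 1# → v < 1#
    v<1 (inj₁ w<1) = <-trans v<t (<-trans t<w w<1)
    v<1 (inj₂ w≈1) = <-respʳ-≈ w≈1 (<-trans v<t t<w)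

    0≤g1 : w ≤ 1# → 0# ≤ eval (suc d) f 1# → 0# ≤ eval d P.cofactor 1#
    0≤g1 w≤1 0≤f1 = 0≤-resp-≈ (begin
        (1# - v) ⁻¹ * eval (suc d) f 1#                       ≈⟨ *-congˡ (eval-cong (suc d) P.factorised refl) ⟩
        (1# - v) ⁻¹ * eval (suc d) (mulLinear v P.cofactor) 1#  ≈⟨ *-congˡ (eval-mulLinear d v 1# P.degree) ⟩
        (1# - v) ⁻¹ * ((1# - v) * eval d P.cofactor 1#)       ≈⟨ *-assoc _ _ _ ⟨
        (1# - v) ⁻¹ * (1# - v) * eval d P.cofactor 1#         ≈⟨ *-congʳ (⁻¹-inverseˡ (0<x⇒x≉0 0<1-v)) ⟩
        1# * eval d P.cofactor 1#                             ≈⟨ *-identityˡ _ ⟩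
        eval d P.cofactor 1#                                  ∎)
      (*-nonneg (inj₁ (⁻¹-positive 0<1-v)) 0≤f1)
      where
      0<1-v : 0# < 1# - v
      0<1-v = x<y⇒0<y-x (v<1 w≤1)

  ⟨*⟩-cong : ∀ ws {f g} → f ≋ g → ws ⟨*⟩ f ≋ ws ⟨*⟩ g
  ⟨*⟩-cong []       f≋g = f≋g
  ⟨*⟩-cong (w ∷ ws) f≋g = mulLinear-cong w (⟨*⟩-cong ws f≋g)

  ⟨*⟩-scale : ∀ ws c f → ws ⟨*⟩ (λ k → c * f k) ≋ (λ k → c * (ws ⟨*⟩ f) k)
  ⟨*⟩-scale []       c f k = refl
  ⟨*⟩-scale (w ∷ ws) c f k = trans (mulLinear-cong w (⟨*⟩-scale ws c f) k) (mulLinear-scale w c (ws ⟨*⟩ f) k)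

  ⟨*⟩-mulLinear : ∀ ws w f → ws ⟨*⟩ mulLinear w f ≋ mulLinear w (ws ⟨*⟩ f)
  ⟨*⟩-mulLinear []       w f k = refl
  ⟨*⟩-mulLinear (v ∷ ws) w f k = trans (mulLinear-cong v (⟨*⟩-mulLinear ws w f) k) (mulLinear-comm v w (ws ⟨*⟩ f) k)

  ∏-degree : ∀ zs → Degree≤ (length zs) (∏ zs)
  ∏-degree []       (s≤s z≤n) = refl
  ∏-degree (z ∷ zs) = mulLinear-degree (length zs) z (∏-degree zs)

  ∏-leading : ∀ zs → ∏ zs (length zs) ≈ 1#
  ∏-leading []       = refl
  ∏-leading (z ∷ zs) = trans (mulLinear-leading (length zs) z (∏-degree zs)) (∏-leading zs)

  -- The value of ∏ zs at x.
  ∏-at : List Carrier → Carrier → Carrier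
  ∏-at zs = eval (length zs) (∏ zs)

  ∏-at-∷ : ∀ z zs x → ∏-at (z ∷ zs) x ≈ (x - z) * ∏-at zs x
  ∏-at-∷ z zs x = eval-mulLinear (length zs) z x (∏-degree zs)

  ∏-positive : ∀ {zs x} → All (_< x) zs → 0# < ∏-at zs x
  ∏-positive []                   = 0<1
  ∏-positive {z ∷ zs} {x} (z<x ∷ zs<x) =
    <-respʳ-≈ (sym (∏-at-∷ z zs x)) (*-positive (x<y⇒0<y-x z<x) (∏-positive zs<x))

  ∏-roots : ∀ zs → All (λ z → ∏-at zs z ≈ 0#) zs
  ∏-roots []       = []
  ∏-roots (z ∷ zs) =
    trans (∏-at-∷ z zs z) (solve 2 (λ z u → (z :- z) :* u := :0) refl z (∏-at zs z)) ∷
    All.map (λ {x} root → trans (∏-at-∷ z zs x) (trans (*-congˡ root) (zeroʳ (x - z)))) (∏-roots zs)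

  -- The step operator on polynomials

  -- T a γ f = (1 - x) (θ + a) f - γ x f, where θ = x d/dx, collected by powers of x as
  -- (θ + a) f - x (θ + a + γ) f.  Formally, (θ + a) (f (1 - x)^γ) = (T a γ f) (1 - x)^(γ - 1).
  T : Carrier → Carrier → Series → Series
  T a γ f k = (fromℕ k + a) * f k - shift (λ i → (fromℕ i + a + γ) * f i) k

  module _ (a γ : Carrier) where

    T-cong : ∀ {f g} → f ≋ g → T a γ f ≋ T a γ g
    T-cong f≋g k = +-cong (*-congˡ (f≋g k)) (-‿cong (shift-cong (λ i → *-congˡ (f≋g i)) k))

    T-scale : ∀ c f → T a γ (λ k → c * f k) ≋ (λ k → c * T a γ f k)
    T-scale c f zero = solve 4 (λ n a c f → (n :+ a) :* (c :* f) :- :0 := c :* ((n :+ a) :* f :- :0)) refl 0# a c (f 0)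
    T-scale c f (suc k) =
      solve 6 (λ n a g c f₀ f₁ → (:1 :+ n :+ a) :* (c :* f₁) :- (n :+ a :+ g) :* (c :* f₀)
                           := c :* ((:1 :+ n :+ a) :* f₁ :- (n :+ a :+ g) :* f₀)) refl
        (fromℕ k) a γ c (f k) (f (suc k))

    T-mulLinear : ∀ z f → T a γ (mulLinear z f) ≋ (λ k → mulLinear z (T a γ f) k - shift (mulLinear 1# f) k)
    T-mulLinear z f zero =
      solve 3 (λ a z f → (:0 :+ a) :* (:0 :- z :* f) :- :0 := :0 :- z :* ((:0 :+ a) :* f :- :0) :- :0) refl a z (f 0)
    T-mulLinear z f (suc zero) =
      solve 5 (λ a g z f₀ f₁ →
          (:1 :+ :0 :+ a) :* (f₀ :- z :* f₁) :- (:0 :+ a :+ g) :* (:0 :- z :* f₀)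
            := (:0 :+ a) :* f₀ :- :0 :- z :* ((:1 :+ :0 :+ a) :* f₁ :- (:0 :+ a :+ g) :* f₀) :- (:0 :- :1 :* f₀)) refl
        a γ z (f 0) (f 1)
    T-mulLinear z f (suc (suc k)) =
      solve 7 (λ n a g z f₀ f₁ f₂ →
          (:1 :+ (:1 :+ n) :+ a) :* (f₁ :- z :* f₂) :- (:1 :+ n :+ a :+ g) :* (f₀ :- z :* f₁)
            := ((:1 :+ n :+ a) :* f₁ :- (n :+ a :+ g) :* f₀)
                 :- z :* ((:1 :+ (:1 :+ n) :+ a) :* f₂ :- (:1 :+ n :+ a :+ g) :* f₁) :- (f₀ :- :1 :* f₁)) refl
        (fromℕ k) a γ z (f k) (f (suc k)) (f (suc (suc k)))

    T-degree : ∀ d {f} → Degree≤ d f → Degree≤ (suc d) (T a γ f)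
    T-degree d {f} deg {suc k} (s≤s d<k) = trans
      (+-cong (*-congˡ (deg (ℕ.m≤n⇒m≤1+n d<k))) (-‿cong (*-congˡ (deg d<k))))
      (solve 2 (λ u v → u :* :0 :- v :* :0 := :0) refl (fromℕ (suc k) + a) (fromℕ k + a + γ))

    T-leading : ∀ d {f} → Degree≤ d f → T a γ f (suc d) ≈ - ((fromℕ d + a + γ) * f d)
    T-leading d {f} deg = trans (+-congʳ (*-congˡ (deg (ℕ.n<1+n d))))
      (solve 2 (λ u v → u :* :0 :- v := :- v) refl (fromℕ (suc d) + a) ((fromℕ d + a + γ) * f d))

    -- The value of T a γ (∏ zs) at x; its degree is at most 1 + length zs.
    T∏-at : List Carrier → Carrier → Carrier
    T∏-at zs = eval (suc (length zs)) (T a γ (∏ zs))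

    T∏-at-∷ : ∀ z zs x → T∏-at (z ∷ zs) x ≈ (x - z) * T∏-at zs x - x * ((x - 1#) * ∏-at zs x)
    T∏-at-∷ z zs x = begin
      T∏-at (z ∷ zs) x
        ≈⟨ eval-cong (suc (suc d)) (T-mulLinear z (∏ zs)) refl ⟩
      eval (suc (suc d)) (λ k → mulLinear z (T a γ (∏ zs)) k - shift (mulLinear 1# (∏ zs)) k) x
        ≈⟨ eval-minus (suc (suc d)) (mulLinear z (T a γ (∏ zs))) (shift (mulLinear 1# (∏ zs))) x ⟩
      eval (suc (suc d)) (mulLinear z (T a γ (∏ zs))) x - eval (suc (suc d)) (shift (mulLinear 1# (∏ zs))) x
        ≈⟨ +-cong (eval-mulLinear (suc d) z x (T-degree d (∏-degree zs)))
             (-‿cong (trans (eval-shift (suc d) (mulLinear 1# (∏ zs)) x)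
                            (*-congˡ (eval-mulLinear d 1# x (∏-degree zs))))) ⟩
      (x - z) * T∏-at zs x - x * ((x - 1#) * ∏-at zs x)
        ∎
      where d = length zs

    -- At 1 only the term - γ x f of T survives.
    T∏-at-1 : ∀ zs → T∏-at zs 1# ≈ - γ * ∏-at zs 1#
    T∏-at-1 [] =
      solve 2 (λ a g → (:0 :+ a) :* :1 :- :0 :+ :1 :* ((:1 :+ :0 :+ a) :* :0 :- (:0 :+ a :+ g) :* :1) := (:- g) :* :1) refl a γ
    T∏-at-1 (z ∷ zs) = begin
      T∏-at (z ∷ zs) 1#
        ≈⟨ T∏-at-∷ z zs 1# ⟩
      (1# - z) * T∏-at zs 1# - 1# * ((1# - 1#) * ∏-at zs 1#)
        ≈⟨ +-congʳ (*-congˡ (T∏-at-1 zs)) ⟩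
      (1# - z) * (- γ * ∏-at zs 1#) - 1# * ((1# - 1#) * ∏-at zs 1#)
        ≈⟨ solve 3 (λ z g u → (:1 :- z) :* ((:- g) :* u) :- :1 :* ((:1 :- :1) :* u) := (:- g) :* ((:1 :- z) :* u)) refl
             z γ (∏-at zs 1#) ⟩
      - γ * ((1# - z) * ∏-at zs 1#)
        ≈⟨ *-congˡ (∏-at-∷ z zs 1#) ⟨
      - γ * ∏-at (z ∷ zs) 1#
        ∎

    -- T (∏ zs) alternates along z₁, ..., zₘ, 0, starting with a positive value.  Adjoining a zero z
    -- above all of zs gives the value z (1 - z) ∏ zs (z) > 0 at z.  At the old points x (at which
    -- ∏ zs or x vanishes) the value is multiplied by x - z < 0.
    T∏-alternating : 0# < a → ∀ {t} zs → t ≤ 1# → Descending t zs → Alternating (T∏-at zs) zs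
    T∏-alternating 0<a [] _ _ = <-respʳ-≈
      (solve 2 (λ a v → a := (:0 :+ a) :* :1 :- :0 :+ :0 :* v) refl a _) 0<a
    T∏-alternating 0<a {t} (z ∷ zs) t≤1 (z<t , zs↓) =
      <-respʳ-≈ at-z (*-positive (*-positive (descending-positive zs zs↓) (x<y⇒0<y-x z<1)) (∏-positive (All.map proj₂ zs<z))) ,
      alternating-transport zs
        (All.map (λ { {x} ((_ , x<z) , root) → flip x<z (*-vanish x root) }) (All.zip (zs<z , ∏-roots zs)))
        (flip (descending-positive zs zs↓) (zeroˡ _))
        (T∏-alternating 0<a zs (inj₁ z<1) zs↓)
      where
      z<1 : z < 1#
      z<1 = [ <-trans z<t , (λ t≈1 → <-respʳ-≈ t≈1 z<t) ]′ t≤1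

      zs<z : All (λ x → 0# < x × x < z) zs
      zs<z = descending-all zs zs↓

      at-z : z * (1# - z) * ∏-at zs z ≈ T∏-at (z ∷ zs) z
      at-z = sym (trans (T∏-at-∷ z zs z)
        (solve 3 (λ z u v → (z :- z) :* u :- z :* ((z :- :1) :* v) := z :* (:1 :- z) :* v) refl z (T∏-at zs z) (∏-at zs z)))

      *-vanish : ∀ x → ∏-at zs x ≈ 0# → x * ((x - 1#) * ∏-at zs x) ≈ 0#
      *-vanish x root = trans (*-congˡ (*-congˡ root)) (solve 1 (λ x → x :* ((x :- :1) :* :0) := :0) refl x)

      flip : ∀ {x} → x < z → x * ((x - 1#) * ∏-at zs x) ≈ 0# → SameSign (T∏-at zs) (λ x → - T∏-at (z ∷ zs) x) x
      flip {x} x<z vanish = sameSign-multiply {T∏-at zs} {λ x → - T∏-at (z ∷ zs) x} (x<y⇒0<y-x x<z) (begin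
        T∏-at zs x * (z - x)              ≈⟨ solve 3 (λ x z u → u :* (z :- x) := :- ((x :- z) :* u :- :0)) refl x z (T∏-at zs x) ⟩
        - ((x - z) * T∏-at zs x - 0#)     ≈⟨ -‿cong (+-congˡ (-‿cong vanish)) ⟨
        - ((x - z) * T∏-at zs x - x * ((x - 1#) * ∏-at zs x))  ≈⟨ -‿cong (T∏-at-∷ z zs x) ⟨
        - T∏-at (z ∷ zs) x                ∎)

  -- f is a nonzero multiple of a product of m linear factors with distinct zeros in (0,1).
  record ZerosInUnitInterval (f : Series) (m : ℕ) : Set where
    field
      scalar     : Carrier
      zeros      : List Carrier
      scalar≉0   : ¬ (scalar ≈ 0#)
      count      : length zeros ≡ m
      descending : Descending 1# zeros
      factorised : f ≋ (λ k → scalar * ∏ zeros k)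

  -- f is a nonzero multiple of a product of linear factors with distinct zeros in (0,1)
  -- and one further linear factor with its zero in [1,∞).
  record ZerosBeyond (f : Series) : Set where
    field
      scalar     : Carrier
      last       : Carrier
      zeros      : List Carrier
      scalar≉0   : ¬ (scalar ≈ 0#)
      descending : Descending 1# zeros
      1≤last     : 1# ≤ last
      factorised : f ≋ (λ k → scalar * ∏ (last ∷ zeros) k)

  zeros<1 : ∀ zs → Descending 1# zs → All (_< 1#) zs
  zeros<1 zs zs↓ = All.map proj₂ (descending-all zs zs↓)

  T∏-zeros : ∀ {a γ} → 0# < a → 0# < γ → ∀ zs → Descending 1# zs →
             ZerosInUnitInterval (T a γ (∏ zs)) (suc (length zs))
  T∏-zeros {a} {γ} 0<a 0<γ zs zs↓ = record
    { scalar = - κ ; zeros = P.root ∷ E.roots ; scalar≉0 = 0<x⇒-x≉0 E.positive-at-0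
    ; count = ≡.cong suc E.count ; descending = P.root<t , E.descending
    ; factorised = λ k → begin
        T a γ (∏ zs) k                         ≈⟨ solve 1 (λ u → u := :- (:- u)) refl _ ⟩
        - f k                                  ≈⟨ -‿cong (P.factorised k) ⟩
        - mulLinear P.root P.cofactor k        ≈⟨ -‿cong (mulLinear-cong P.root E.factorised k) ⟩
        - ((P.root ∷ E.roots) ⟨*⟩ E.cofactor) k  ≈⟨ -‿cong (⟨*⟩-cong (P.root ∷ E.roots) constant k) ⟩
        - ((P.root ∷ E.roots) ⟨*⟩ (λ k → κ * one k)) k ≈⟨ -‿cong (⟨*⟩-scale (P.root ∷ E.roots) κ one k) ⟩
        - (κ * ∏ (P.root ∷ E.roots) k)         ≈⟨ solve 2 (λ c u → :- (c :* u) := (:- c) :* u) refl κ _ ⟩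
        - κ * ∏ (P.root ∷ E.roots) k           ∎ }
    where
    d = length zs

    -- The sign makes f positive at 1, where T (∏ zs) takes the value - γ ∏ zs (1) < 0.
    f : Series
    f k = - T a γ (∏ zs) k

    f-at : ∀ x → - T∏-at a γ zs x ≈ eval (suc d) f x
    f-at x = sym (eval-neg (suc d) (T a γ (∏ zs)) x)

    f-degree : Degree≤ (suc d) f
    f-degree d<k = trans (-‿cong (T-degree a γ d (∏-degree zs) d<k)) (solve 0 (:- :0 := :0) refl)

    0<f1 : 0# < eval (suc d) f 1#
    0<f1 = <-respʳ-≈ (begin
      γ * ∏-at zs 1#      ≈⟨ solve 2 (λ g u → g :* u := :- ((:- g) :* u)) refl γ (∏-at zs 1#) ⟩
      - (- γ * ∏-at zs 1#)  ≈⟨ -‿cong (T∏-at-1 a γ zs) ⟨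
      - T∏-at a γ zs 1#   ≈⟨ f-at 1# ⟩
      eval (suc d) f 1#   ∎) (*-positive 0<γ (∏-positive (zeros<1 zs zs↓)))

    same : ∀ x → SameSign (T∏-at a γ zs) (λ x → - eval (suc d) f x) x
    same x = sameSign-≈ {T∏-at a γ zs} {λ x → - eval (suc d) f x}
      (trans (solve 1 (λ u → u := :- (:- u)) refl _) (-‿cong (f-at x)))

    module P = Peeled (peel d zs f-degree zs↓ 0<f1
      (alternating-transport zs (All.universal same zs) (same 0#) (T∏-alternating a γ 0<a zs (inj₂ refl) zs↓)))
    module E = Extracted (extract 0 d zs (≡.sym (ℕ.+-identityʳ d)) P.degree P.descending P.alternating)

    κ : Carrier
    κ = E.cofactor 0

    constant : E.cofactor ≋ (λ k → κ * one k)
    constant zero    = sym (*-identityʳ κ)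
    constant (suc k) = trans (E.degree (s≤s z≤n)) (sym (zeroʳ κ))

  T∏-zeros-beyond : ∀ {a γ} → 0# < a → γ ≤ 0# → ∀ zs → Descending 1# zs → 0# < fromℕ (length zs) + a + γ →
                    ZerosBeyond (T a γ (∏ zs))
  T∏-zeros-beyond {a} {γ} 0<a γ≤0 zs zs↓ 0<d+a+γ = record
    { scalar = c₁ ; last = w ; zeros = E.roots ; scalar≉0 = c₁≉0
    ; descending = E.descending ; 1≤last = 0≤y-x⇒x≤y 0≤w-1
    ; factorised = λ k → begin
        T a γ (∏ zs) k                                ≈⟨ E.factorised k ⟩
        (E.roots ⟨*⟩ E.cofactor) k                    ≈⟨ ⟨*⟩-cong E.roots linear k ⟩
        (E.roots ⟨*⟩ (λ k → c₁ * mulLinear w one k)) k  ≈⟨ ⟨*⟩-scale E.roots c₁ (mulLinear w one) k ⟩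
        c₁ * (E.roots ⟨*⟩ mulLinear w one) k          ≈⟨ *-congˡ (⟨*⟩-mulLinear E.roots w one k) ⟩
        c₁ * ∏ (w ∷ E.roots) k                        ∎ }
    where
    d = length zs

    module E = Extracted (extract 1 (suc d) zs (≡.sym (ℕ.+-comm d 1)) (T-degree a γ d (∏-degree zs)) zs↓
      (T∏-alternating a γ 0<a zs (inj₂ refl) zs↓))

    -- The cofactor c₀ + c₁ x of the zeros in (0,1), and its zero w = - c₀ / c₁.
    c₀ c₁ w : Carrier
    c₀ = E.cofactor 0
    c₁ = E.cofactor 1
    w  = c₀ * (- c₁) ⁻¹

    0<-c₁ : 0# < - c₁
    0<-c₁ = <-respʳ-≈ (begin
      fromℕ d + a + γ              ≈⟨ solve 1 (λ u → u := :- (:- (u :* :1))) refl _ ⟩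
      - - ((fromℕ d + a + γ) * 1#) ≈⟨ -‿cong (-‿cong (*-congˡ (∏-leading zs))) ⟨
      - - ((fromℕ d + a + γ) * ∏ zs d) ≈⟨ -‿cong (T-leading a γ d (∏-degree zs)) ⟨
      - T a γ (∏ zs) (suc d)       ≈⟨ -‿cong E.leading ⟨
      - c₁                         ∎) 0<d+a+γ

    c₁≉0 : ¬ (c₁ ≈ 0#)
    c₁≉0 c₁≈0 = 0<x⇒x≉0 0<-c₁ (trans (-‿cong c₁≈0) (solve 0 (:- :0 := :0) refl))

    c₁*w : c₁ * w ≈ - c₀
    c₁*w = begin
      c₁ * (c₀ * (- c₁) ⁻¹)         ≈⟨ solve 3 (λ c e i → c :* (e :* i) := :- (e :* ((:- c) :* i))) refl c₁ c₀ _ ⟩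
      - (c₀ * (- c₁ * (- c₁) ⁻¹))   ≈⟨ -‿cong (*-congˡ (⁻¹-inverseʳ (0<x⇒x≉0 0<-c₁))) ⟩
      - (c₀ * 1#)                   ≈⟨ -‿cong (*-identityʳ c₀) ⟩
      - c₀                          ∎

    linear : E.cofactor ≋ (λ k → c₁ * mulLinear w one k)
    linear zero = begin
      c₀                     ≈⟨ solve 1 (λ c → c := :- (:- c)) refl c₀ ⟩
      - - c₀                 ≈⟨ -‿cong c₁*w ⟨
      - (c₁ * w)             ≈⟨ solve 2 (λ c w → :- (c :* w) := c :* (:0 :- w :* :1)) refl c₁ w ⟩
      c₁ * (0# - w * 1#)     ∎
    linear (suc zero)    = solve 2 (λ c w → c := c :* (:1 :- w :* :0)) refl c₁ w
    linear (suc (suc k)) = trans (E.degree (s≤s (s≤s z≤n)))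
      (solve 2 (λ c w → :0 := c :* (:0 :- w :* :0)) refl c₁ w)

    0≤T1 : 0# ≤ T∏-at a γ zs 1#
    0≤T1 = 0≤-resp-≈ (sym (T∏-at-1 a γ zs))
      (*-nonneg (0≤-resp-≈ (+-identityˡ (- γ)) (x≤y⇒0≤y-x γ≤0)) (inj₁ (∏-positive (zeros<1 zs zs↓))))

    -- w - 1 = (c₀ + c₁) / (- c₁), and c₀ + c₁ is the value of the cofactor at 1.
    0≤w-1 : 0# ≤ w - 1#
    0≤w-1 = 0≤-resp-≈ (begin
      (c₀ + 1# * c₁) * (- c₁) ⁻¹             ≈⟨ solve 3 (λ e c i → (e :+ :1 :* c) :* i := e :* i :- (:- c) :* i) refl c₀ c₁ _ ⟩
      w - - c₁ * (- c₁) ⁻¹                   ≈⟨ +-congˡ (-‿cong (⁻¹-inverseʳ (0<x⇒x≉0 0<-c₁))) ⟩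
      w - 1#                                 ∎)
      (*-nonneg (E.nonneg-at-1 (inj₂ refl) 0≤T1) (inj₁ (⁻¹-positive 0<-c₁)))

  -- The polynomial p with ∏ (θ + a) (1 - x)^(γ + m) = p (1 - x)^γ, the product being over the
  -- list of the m numbers a (weight-[1-x]^).
  rodrigues : List Carrier → Carrier → Series
  rodrigues []       γ = one
  rodrigues (a ∷ as) γ = T a (γ + 1#) (rodrigues as (γ + 1#))

  -1<γ⇒0<γ+1 : ∀ {γ} → - 1# < γ → 0# < γ + 1#
  -1<γ⇒0<γ+1 {γ} -1<γ = <-respʳ-≈ (solve 1 (λ g → g :- (:- :1) := g :+ :1) refl γ) (x<y⇒0<y-x -1<γ)

  -1<γ⇒-1<γ+1 : ∀ {γ} → - 1# < γ → - 1# < γ + 1#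
  -1<γ⇒-1<γ+1 {γ} -1<γ = <-trans -1<γ (<-respˡ-≈ (+-identityʳ γ) (+-monoʳ-< γ 0<1))

  rodrigues-zeros : ∀ as γ → All (0# <_) as → - 1# < γ → ZerosInUnitInterval (rodrigues as γ) (length as)
  rodrigues-zeros [] γ [] -1<γ = record
    { scalar = 1# ; zeros = [] ; scalar≉0 = 0<x⇒x≉0 0<1 ; count = ≡.refl ; descending = 0<1
    ; factorised = λ k → sym (*-identityˡ (one k)) }
  rodrigues-zeros (a ∷ as) γ (0<a ∷ 0<as) -1<γ = record
    { scalar = Z.scalar * Z′.scalar ; zeros = Z′.zeros ; scalar≉0 = *-nonzero Z.scalar≉0 Z′.scalar≉0
    ; count = ≡.trans Z′.count (≡.cong suc Z.count) ; descending = Z′.descending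
    ; factorised = λ k → begin
        T a (γ + 1#) (rodrigues as (γ + 1#)) k              ≈⟨ T-cong a (γ + 1#) Z.factorised k ⟩
        T a (γ + 1#) (λ i → Z.scalar * ∏ Z.zeros i) k       ≈⟨ T-scale a (γ + 1#) Z.scalar (∏ Z.zeros) k ⟩
        Z.scalar * T a (γ + 1#) (∏ Z.zeros) k               ≈⟨ *-congˡ (Z′.factorised k) ⟩
        Z.scalar * (Z′.scalar * ∏ Z′.zeros k)               ≈⟨ *-assoc _ _ _ ⟨
        Z.scalar * Z′.scalar * ∏ Z′.zeros k                 ∎ }
    where
    module Z  = ZerosInUnitInterval (rodrigues-zeros as (γ + 1#) 0<as (-1<γ⇒-1<γ+1 -1<γ))
    module Z′ = ZerosInUnitInterval (T∏-zeros 0<a (-1<γ⇒0<γ+1 -1<γ) Z.zeros Z.descending)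

  rodrigues-zeros-beyond : ∀ a as γ → All (0# <_) (a ∷ as) → - (1# + 1#) < γ → γ ≤ - 1# →
                           0# < fromℕ (length as) + a + (γ + 1#) → ZerosBeyond (rodrigues (a ∷ as) γ)
  rodrigues-zeros-beyond a as γ (0<a ∷ 0<as) -2<γ γ≤-1 0<lead = record
    { scalar = Z.scalar * Z′.scalar ; last = Z′.last ; zeros = Z′.zeros ; scalar≉0 = *-nonzero Z.scalar≉0 Z′.scalar≉0
    ; descending = Z′.descending ; 1≤last = Z′.1≤last
    ; factorised = λ k → begin
        T a (γ + 1#) (rodrigues as (γ + 1#)) k              ≈⟨ T-cong a (γ + 1#) Z.factorised k ⟩
        T a (γ + 1#) (λ i → Z.scalar * ∏ Z.zeros i) k       ≈⟨ T-scale a (γ + 1#) Z.scalar (∏ Z.zeros) k ⟩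
        Z.scalar * T a (γ + 1#) (∏ Z.zeros) k               ≈⟨ *-congˡ (Z′.factorised k) ⟩
        Z.scalar * (Z′.scalar * ∏ (Z′.last ∷ Z′.zeros) k)   ≈⟨ *-assoc _ _ _ ⟨
        Z.scalar * Z′.scalar * ∏ (Z′.last ∷ Z′.zeros) k     ∎ }
    where
    -1<γ+1 : - 1# < γ + 1#
    -1<γ+1 = 0<y-x⇒x<y (<-respʳ-≈ (solve 1 (λ g → g :- (:- (:1 :+ :1)) := g :+ :1 :- (:- :1)) refl γ) (x<y⇒0<y-x -2<γ))

    γ+1≤0 : γ + 1# ≤ 0#
    γ+1≤0 = 0≤y-x⇒x≤y (0≤-resp-≈ (solve 1 (λ g → (:- :1) :- g := :0 :- (g :+ :1)) refl γ) (x≤y⇒0≤y-x γ≤-1))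

    module Z  = ZerosInUnitInterval (rodrigues-zeros as (γ + 1#) 0<as -1<γ+1)
    module Z′ = ZerosBeyond (T∏-zeros-beyond 0<a γ+1≤0 Z.zeros Z.descending
      (≡.subst (λ m → 0# < fromℕ m + a + (γ + 1#)) (≡.sym Z.count) 0<lead))


  -- The algebra of power series

  ⊛-cong : ∀ {f f′ g g′} → f ≋ f′ → g ≋ g′ → f ⊛ g ≋ f′ ⊛ g′
  ⊛-cong f≋ g≋ zero    = +-congʳ (*-cong (f≋ 0) (g≋ 0))
  ⊛-cong f≋ g≋ (suc k) = +-cong (*-cong (f≋ 0) (g≋ (suc k))) (⊛-cong (f≋ ∘ suc) g≋ k)

  ⊛-zeroˡ : ∀ g → (λ _ → 0#) ⊛ g ≋ (λ _ → 0#)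
  ⊛-zeroˡ g zero    = solve 1 (λ u → :0 :* u :+ :0 := :0) refl (g 0)
  ⊛-zeroˡ g (suc k) = trans (+-congˡ (⊛-zeroˡ g k)) (solve 1 (λ u → :0 :* u :+ :0 := :0) refl (g (suc k)))

  ⊛-identityˡ : ∀ g → one ⊛ g ≋ g
  ⊛-identityˡ g zero    = solve 1 (λ u → :1 :* u :+ :0 := u) refl (g 0)
  ⊛-identityˡ g (suc k) = trans (+-congˡ (⊛-zeroˡ g k)) (solve 1 (λ u → :1 :* u :+ :0 := u) refl (g (suc k)))

  ⊛-distribʳ-+ : ∀ f g h → (λ k → f k + g k) ⊛ h ≋ (λ k → (f ⊛ h) k + (g ⊛ h) k)
  ⊛-distribʳ-+ f g h zero = solve 3 (λ a b c → (a :+ b) :* c :+ :0 := a :* c :+ :0 :+ (b :* c :+ :0)) refl (f 0) (g 0) (h 0)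
  ⊛-distribʳ-+ f g h (suc k) = trans (+-congˡ (⊛-distribʳ-+ (tail f) (tail g) h k))
    (solve 5 (λ a b c u v → (a :+ b) :* c :+ (u :+ v) := a :* c :+ u :+ (b :* c :+ v)) refl
      (f 0) (g 0) (h (suc k)) ((tail f ⊛ h) k) ((tail g ⊛ h) k))

  ⊛-scaleˡ : ∀ c f g → (λ k → c * f k) ⊛ g ≋ (λ k → c * (f ⊛ g) k)
  ⊛-scaleˡ c f g zero = solve 3 (λ c a b → c :* a :* b :+ :0 := c :* (a :* b :+ :0)) refl c (f 0) (g 0)
  ⊛-scaleˡ c f g (suc k) = trans (+-congˡ (⊛-scaleˡ c (tail f) g k))
    (solve 4 (λ c a b u → c :* a :* b :+ c :* u := c :* (a :* b :+ u)) refl c (f 0) (g (suc k)) ((tail f ⊛ g) k))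

  ⊛-distribʳ-minus : ∀ f g h → (λ k → f k - g k) ⊛ h ≋ (λ k → (f ⊛ h) k - (g ⊛ h) k)
  ⊛-distribʳ-minus f g h zero = solve 3 (λ a b c → (a :- b) :* c :+ :0 := a :* c :+ :0 :- (b :* c :+ :0)) refl (f 0) (g 0) (h 0)
  ⊛-distribʳ-minus f g h (suc k) = trans (+-congˡ (⊛-distribʳ-minus (tail f) (tail g) h k))
    (solve 5 (λ a b c u v → (a :- b) :* c :+ (u :- v) := a :* c :+ u :- (b :* c :+ v)) refl
      (f 0) (g 0) (h (suc k)) ((tail f ⊛ h) k) ((tail g ⊛ h) k))

  ⊛-shiftˡ : ∀ f g → shift f ⊛ g ≋ shift (f ⊛ g)
  ⊛-shiftˡ f g zero    = solve 1 (λ u → :0 :* u :+ :0 := :0) refl (g 0)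
  ⊛-shiftˡ f g (suc k) = solve 2 (λ u v → :0 :* u :+ v := v) refl (g (suc k)) ((f ⊛ g) k)

  -- The recursion defining f ⊛ g runs over the coefficients of f; this is its mirror image.
  ⊛-tailʳ : ∀ f g k → (f ⊛ g) (suc k) ≈ (f ⊛ tail g) k + f (suc k) * g 0
  ⊛-tailʳ f g zero = solve 4 (λ a b c d → a :* b :+ (c :* d :+ :0) := a :* b :+ :0 :+ c :* d) refl (f 0) (g 1) (f 1) (g 0)
  ⊛-tailʳ f g (suc k) = trans (+-congˡ (⊛-tailʳ (tail f) g k))
    (solve 3 (λ u v w → u :+ (v :+ w) := u :+ v :+ w) refl
      (f 0 * g (suc (suc k))) ((tail f ⊛ tail g) k) (f (suc (suc k)) * g 0))

  ⊛-comm : ∀ f g → f ⊛ g ≋ g ⊛ f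
  ⊛-comm f g zero    = +-congʳ (*-comm (f 0) (g 0))
  ⊛-comm f g (suc k) = begin
    f 0 * g (suc k) + (tail f ⊛ g) k  ≈⟨ +-congˡ (⊛-comm (tail f) g k) ⟩
    f 0 * g (suc k) + (g ⊛ tail f) k  ≈⟨ solve 3 (λ a b u → a :* b :+ u := u :+ b :* a) refl (f 0) (g (suc k)) _ ⟩
    (g ⊛ tail f) k + g (suc k) * f 0  ≈⟨ ⊛-tailʳ g f k ⟨
    (g ⊛ f) (suc k)                   ∎

  ⊛-assoc : ∀ f g h → (f ⊛ g) ⊛ h ≋ f ⊛ (g ⊛ h)
  ⊛-assoc f g h zero =
    solve 3 (λ a b c → (a :* b :+ :0) :* c :+ :0 := a :* (b :* c :+ :0) :+ :0) refl (f 0) (g 0) (h 0)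
  ⊛-assoc f g h (suc k) = begin
    (f 0 * g 0 + 0#) * h (suc k) + ((λ i → f 0 * tail g i + (tail f ⊛ g) i) ⊛ h) k
      ≈⟨ +-congˡ (⊛-distribʳ-+ (λ i → f 0 * tail g i) (tail f ⊛ g) h k) ⟩
    (f 0 * g 0 + 0#) * h (suc k) + (((λ i → f 0 * tail g i) ⊛ h) k + ((tail f ⊛ g) ⊛ h) k)
      ≈⟨ +-congˡ (+-cong (⊛-scaleˡ (f 0) (tail g) h k) (⊛-assoc (tail f) g h k)) ⟩
    (f 0 * g 0 + 0#) * h (suc k) + (f 0 * (tail g ⊛ h) k + (tail f ⊛ (g ⊛ h)) k)
      ≈⟨ solve 5 (λ a b c u v → (a :* b :+ :0) :* c :+ (a :* u :+ v) := a :* (b :* c :+ u) :+ v) refl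
           (f 0) (g 0) (h (suc k)) ((tail g ⊛ h) k) ((tail f ⊛ (g ⊛ h)) k) ⟩
    f 0 * (g 0 * h (suc k) + (tail g ⊛ h) k) + (tail f ⊛ (g ⊛ h)) k
      ∎

  ⊛-distribˡ-minus : ∀ f g h → f ⊛ (λ k → g k - h k) ≋ (λ k → (f ⊛ g) k - (f ⊛ h) k)
  ⊛-distribˡ-minus f g h k = begin
    (f ⊛ (λ i → g i - h i)) k  ≈⟨ ⊛-comm f (λ i → g i - h i) k ⟩
    ((λ i → g i - h i) ⊛ f) k  ≈⟨ ⊛-distribʳ-minus g h f k ⟩
    (g ⊛ f) k - (h ⊛ f) k      ≈⟨ +-cong (⊛-comm g f k) (-‿cong (⊛-comm h f k)) ⟩
    (f ⊛ g) k - (f ⊛ h) k      ∎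

  ⊛-scaleʳ : ∀ c f g → f ⊛ (λ k → c * g k) ≋ (λ k → c * (f ⊛ g) k)
  ⊛-scaleʳ c f g k = begin
    (f ⊛ (λ i → c * g i)) k  ≈⟨ ⊛-comm f (λ i → c * g i) k ⟩
    ((λ i → c * g i) ⊛ f) k  ≈⟨ ⊛-scaleˡ c g f k ⟩
    c * (g ⊛ f) k            ≈⟨ *-congˡ (⊛-comm g f k) ⟩
    c * (f ⊛ g) k            ∎

  ⊛-shiftʳ : ∀ f g → f ⊛ shift g ≋ shift (f ⊛ g)
  ⊛-shiftʳ f g k = begin
    (f ⊛ shift g) k    ≈⟨ ⊛-comm f (shift g) k ⟩
    (shift g ⊛ f) k    ≈⟨ ⊛-shiftˡ g f k ⟩
    shift (g ⊛ f) k    ≈⟨ shift-cong (⊛-comm g f) k ⟩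
    shift (f ⊛ g) k    ∎

  -- The Euler operator x d/dx, a derivation of the product of series (θ-⊛).
  θ : Series → Series
  θ f k = fromℕ k * f k

  θ-⊛ : ∀ f g → θ (f ⊛ g) ≋ (λ k → (θ f ⊛ g) k + (f ⊛ θ g) k)
  θ-⊛ f g zero =
    solve 2 (λ a b → :0 :* (a :* b :+ :0) := (:0 :* a) :* b :+ :0 :+ (a :* (:0 :* b) :+ :0)) refl (f 0) (g 0)
  θ-⊛ f g (suc k) = begin
    (1# + fromℕ k) * (f 0 * g (suc k) + (tail f ⊛ g) k)
      ≈⟨ solve 4 (λ n a b u → (:1 :+ n) :* (a :* b :+ u) := u :+ n :* u :+ a :* ((:1 :+ n) :* b)) refl
           (fromℕ k) (f 0) (g (suc k)) ((tail f ⊛ g) k) ⟩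
    (tail f ⊛ g) k + fromℕ k * (tail f ⊛ g) k + f 0 * (fromℕ (suc k) * g (suc k))
      ≈⟨ +-congʳ (+-congˡ (θ-⊛ (tail f) g k)) ⟩
    (tail f ⊛ g) k + ((θ (tail f) ⊛ g) k + (tail f ⊛ θ g) k) + f 0 * (fromℕ (suc k) * g (suc k))
      ≈⟨ solve 6 (λ u v w a b c → u :+ (v :+ w) :+ a :* b := (:0 :* a) :* c :+ (u :+ v) :+ (a :* b :+ w)) refl
           ((tail f ⊛ g) k) ((θ (tail f) ⊛ g) k) ((tail f ⊛ θ g) k) (f 0) (fromℕ (suc k) * g (suc k)) (g (suc k)) ⟩
    (0# * f 0) * g (suc k) + ((tail f ⊛ g) k + (θ (tail f) ⊛ g) k) + (f 0 * (fromℕ (suc k) * g (suc k)) + (tail f ⊛ θ g) k)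
      ≈⟨ +-congʳ (+-congˡ (⊛-distribʳ-+ (tail f) (θ (tail f)) g k)) ⟨
    (0# * f 0) * g (suc k) + ((λ i → tail f i + fromℕ i * tail f i) ⊛ g) k + (f ⊛ θ g) (suc k)
      ≈⟨ +-congʳ (+-congˡ (⊛-cong {g = g}
           (λ i → solve 2 (λ n a → a :+ n :* a := (:1 :+ n) :* a) refl (fromℕ i) (f (suc i))) (λ _ → refl) k)) ⟩
    (θ f ⊛ g) (suc k) + (f ⊛ θ g) (suc k)
      ∎

  -- Binomial series

  fromℕ!-positive : ∀ k → 0# < fromℕ (k !)
  fromℕ!-positive zero    = fromℕ-positive 0
  fromℕ!-positive (suc k) =
    <-respʳ-≈ (sym (×1-homo-* (suc k) (k !))) (*-positive (fromℕ-positive k) (fromℕ!-positive k))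

  pochhammer-cong : ∀ {b c} → b ≈ c → ∀ k → pochhammer b k ≈ pochhammer c k
  pochhammer-cong b≈c zero    = refl
  pochhammer-cong b≈c (suc k) = *-cong (pochhammer-cong b≈c k) (+-congʳ b≈c)

  pochhammer-positive : ∀ {b} → 0# < b → ∀ k → 0# < pochhammer b k
  pochhammer-positive 0<b zero    = 0<1
  pochhammer-positive 0<b (suc k) = *-positive (pochhammer-positive 0<b k) (+-pos-nonneg 0<b (fromℕ-nonneg k))

  pochhammer-suc : ∀ b k → pochhammer b (suc k) ≈ b * pochhammer (b + 1#) k
  pochhammer-suc b zero    = solve 1 (λ b → :1 :* (b :+ :0) := b :* :1) refl b
  pochhammer-suc b (suc k) = trans (*-congʳ (pochhammer-suc b k))
    (solve 3 (λ b p n → b :* p :* (b :+ (:1 :+ n)) := b :* (p :* (b :+ :1 :+ n))) refl b (pochhammer (b + 1#) k) (fromℕ k))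

  [1-x]^-cong : ∀ {γ δ} → γ ≈ δ → [1-x]^ γ ≋ [1-x]^ δ
  [1-x]^-cong γ≈δ k = *-congʳ (pochhammer-cong (-‿cong γ≈δ) k)

  [1-x]^-0 : ∀ γ → ([1-x]^ γ) 0 ≈ 1#
  [1-x]^-0 γ = trans (*-congʳ (solve 0 (:1 := :1 :+ :0) refl)) (⁻¹-inverseʳ (0<x⇒x≉0 (fromℕ-positive 0)))

  θ[1-x]^-suc : ∀ γ k → θ ([1-x]^ γ) (suc k) ≈ pochhammer (- γ) (suc k) * fromℕ (k !) ⁻¹
  θ[1-x]^-suc γ k = *-cancelˡ (0<x⇒x≉0 (fromℕ!-positive k)) (begin
    K * (N * (p * M ⁻¹))  ≈⟨ solve 4 (λ k n p i → k :* (n :* (p :* i)) := p :* (n :* k :* i)) refl K N p (M ⁻¹) ⟩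
    p * (N * K * M ⁻¹)    ≈⟨ *-congˡ (*-congʳ (×1-homo-* (suc k) (k !))) ⟨
    p * (M * M ⁻¹)        ≈⟨ *-congˡ (⁻¹-inverseʳ (0<x⇒x≉0 (fromℕ!-positive (suc k)))) ⟩
    p * 1#                ≈⟨ *-congˡ (⁻¹-inverseʳ (0<x⇒x≉0 (fromℕ!-positive k))) ⟨
    p * (K * K ⁻¹)        ≈⟨ solve 3 (λ p k i → p :* (k :* i) := k :* (p :* i)) refl p K (K ⁻¹) ⟩
    K * (p * K ⁻¹)        ∎)
    where
    K = fromℕ (k !)
    M = fromℕ (suc k !)
    N = fromℕ (suc k)
    p = pochhammer (- γ) (suc k)

  -- (1 - x) θ (1 - x)^γ = - γ x (1 - x)^γ.
  [1-x]^-ode : ∀ γ k → θ ([1-x]^ γ) k - shift (θ ([1-x]^ γ)) k ≈ - γ * shift ([1-x]^ γ) k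
  [1-x]^-ode γ zero    = solve 2 (λ u g → :0 :* u :- :0 := (:- g) :* :0) refl (([1-x]^ γ) 0) γ
  [1-x]^-ode γ (suc k) = trans (+-congʳ (θ[1-x]^-suc γ k))
    (solve 4 (λ p g n i → p :* ((:- g) :+ n) :* i :- n :* (p :* i) := (:- g) :* (p :* i)) refl
      (pochhammer (- γ) k) γ (fromℕ k) (fromℕ (k !) ⁻¹))

  -- θ (1 - x)^(γ + 1) = - (γ + 1) x (1 - x)^γ.
  θ[1-x]^[γ+1] : ∀ γ → θ ([1-x]^ (γ + 1#)) ≋ (λ k → - (γ + 1#) * shift ([1-x]^ γ) k)
  θ[1-x]^[γ+1] γ zero    = solve 2 (λ u g → :0 :* u := (:- (g :+ :1)) :* :0) refl (([1-x]^ (γ + 1#)) 0) γ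
  θ[1-x]^[γ+1] γ (suc k) = begin
    θ ([1-x]^ (γ + 1#)) (suc k)                                    ≈⟨ θ[1-x]^-suc (γ + 1#) k ⟩
    pochhammer (- (γ + 1#)) (suc k) * fromℕ (k !) ⁻¹               ≈⟨ *-congʳ (pochhammer-suc (- (γ + 1#)) k) ⟩
    - (γ + 1#) * pochhammer (- (γ + 1#) + 1#) k * fromℕ (k !) ⁻¹
      ≈⟨ *-congʳ (*-congˡ (pochhammer-cong (solve 1 (λ g → (:- (g :+ :1)) :+ :1 := :- g) refl γ) k)) ⟩
    - (γ + 1#) * pochhammer (- γ) k * fromℕ (k !) ⁻¹               ≈⟨ *-assoc _ _ _ ⟩
    - (γ + 1#) * ([1-x]^ γ) k                                      ∎

  -- (1 - x)^(γ + 1) = (1 - x) (1 - x)^γ; both sides have the same constant term and the same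
  -- image under θ.
  [1-x]^[γ+1] : ∀ γ → [1-x]^ (γ + 1#) ≋ (λ k → ([1-x]^ γ) k - shift ([1-x]^ γ) k)
  [1-x]^[γ+1] γ zero = trans ([1-x]^-0 (γ + 1#)) (trans (sym ([1-x]^-0 γ)) (solve 1 (λ u → u := u :- :0) refl _))
  [1-x]^[γ+1] γ (suc k) = *-cancelˡ (0<x⇒x≉0 (fromℕ-positive k)) (begin
    θ ([1-x]^ (γ + 1#)) (suc k)             ≈⟨ θ[1-x]^[γ+1] γ (suc k) ⟩
    - (γ + 1#) * e                          ≈⟨ solve 2 (λ g e → (:- (g :+ :1)) :* e := (:- g) :* e :- e) refl γ e ⟩
    - γ * e - e                             ≈⟨ +-congʳ ([1-x]^-ode γ (suc k)) ⟨
    fromℕ (suc k) * e′ - fromℕ k * e - e    ≈⟨ solve 3 (λ n e e′ → (:1 :+ n) :* e′ :- n :* e :- e := (:1 :+ n) :* (e′ :- e)) refl (fromℕ k) e e′ ⟩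
    fromℕ (suc k) * (e′ - e)                ∎)
    where
    e  = ([1-x]^ γ) k
    e′ = ([1-x]^ γ) (suc k)

  -- By the differential equations of the two factors, G = (1 - x)^(- γ) (1 - x)^γ satisfies
  -- (1 - x) θ G = 0, so it is constant.
  [1-x]^-inverse : ∀ γ → [1-x]^ (- γ) ⊛ [1-x]^ γ ≋ one
  [1-x]^-inverse γ = conclusion
    where
    e e⁻ G : Series
    e  = [1-x]^ γ
    e⁻ = [1-x]^ (- γ)
    G  = e⁻ ⊛ e

    ode : ∀ k → θ G k - shift (θ G) k ≈ 0#
    ode k = begin
      θ G k - shift (θ G) k
        ≈⟨ +-cong (θ-⊛ e⁻ e k) (-‿cong (trans (shift-cong (θ-⊛ e⁻ e) k) (shift-+ (θ e⁻ ⊛ e) (e⁻ ⊛ θ e) k))) ⟩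
      ((θ e⁻ ⊛ e) k + (e⁻ ⊛ θ e) k) - (shift (θ e⁻ ⊛ e) k + shift (e⁻ ⊛ θ e) k)
        ≈⟨ solve 4 (λ a b c d → (a :+ b) :- (c :+ d) := (a :- c) :+ (b :- d)) refl
             ((θ e⁻ ⊛ e) k) ((e⁻ ⊛ θ e) k) (shift (θ e⁻ ⊛ e) k) (shift (e⁻ ⊛ θ e) k) ⟩
      ((θ e⁻ ⊛ e) k - shift (θ e⁻ ⊛ e) k) + ((e⁻ ⊛ θ e) k - shift (e⁻ ⊛ θ e) k)
        ≈⟨ +-cong left right ⟩
      - - γ * shift G k + - γ * shift G k
        ≈⟨ solve 2 (λ g u → (:- (:- g)) :* u :+ (:- g) :* u := :0) refl γ (shift G k) ⟩
      0#
        ∎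
      where
      shift-+ : ∀ f g k → shift (λ i → f i + g i) k ≈ shift f k + shift g k
      shift-+ f g zero    = sym (+-identityˡ 0#)
      shift-+ f g (suc k) = refl

      left : (θ e⁻ ⊛ e) k - shift (θ e⁻ ⊛ e) k ≈ - - γ * shift G k
      left = begin
        (θ e⁻ ⊛ e) k - shift (θ e⁻ ⊛ e) k              ≈⟨ +-congˡ (-‿cong (⊛-shiftˡ (θ e⁻) e k)) ⟨
        (θ e⁻ ⊛ e) k - (shift (θ e⁻) ⊛ e) k            ≈⟨ ⊛-distribʳ-minus (θ e⁻) (shift (θ e⁻)) e k ⟨
        ((λ i → θ e⁻ i - shift (θ e⁻) i) ⊛ e) k        ≈⟨ ⊛-cong {g = e} ([1-x]^-ode (- γ)) (λ _ → refl) k ⟩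
        ((λ i → - - γ * shift e⁻ i) ⊛ e) k             ≈⟨ ⊛-scaleˡ (- - γ) (shift e⁻) e k ⟩
        - - γ * (shift e⁻ ⊛ e) k                       ≈⟨ *-congˡ (⊛-shiftˡ e⁻ e k) ⟩
        - - γ * shift G k                              ∎

      right : (e⁻ ⊛ θ e) k - shift (e⁻ ⊛ θ e) k ≈ - γ * shift G k
      right = begin
        (e⁻ ⊛ θ e) k - shift (e⁻ ⊛ θ e) k              ≈⟨ +-congˡ (-‿cong (⊛-shiftʳ e⁻ (θ e) k)) ⟨
        (e⁻ ⊛ θ e) k - (e⁻ ⊛ shift (θ e)) k            ≈⟨ ⊛-distribˡ-minus e⁻ (θ e) (shift (θ e)) k ⟨
        (e⁻ ⊛ (λ i → θ e i - shift (θ e) i)) k         ≈⟨ ⊛-cong {e⁻} (λ _ → refl) ([1-x]^-ode γ) k ⟩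
        (e⁻ ⊛ (λ i → - γ * shift e i)) k               ≈⟨ ⊛-scaleʳ (- γ) e⁻ (shift e) k ⟩
        - γ * (e⁻ ⊛ shift e) k                         ≈⟨ *-congˡ (⊛-shiftʳ e⁻ e k) ⟩
        - γ * shift G k                                ∎

    θG≈0 : ∀ k → θ G k ≈ 0#
    θG≈0 zero    = zeroˡ (G 0)
    θG≈0 (suc k) = begin
      θ G (suc k)                ≈⟨ solve 2 (λ u v → u := (u :- v) :+ v) refl (θ G (suc k)) (θ G k) ⟩
      θ G (suc k) - θ G k + θ G k  ≈⟨ +-cong (ode (suc k)) (θG≈0 k) ⟩
      0# + 0#                    ≈⟨ +-identityʳ 0# ⟩
      0#                         ∎

    conclusion : G ≋ one
    conclusion zero = begin
      e⁻ 0 * e 0 + 0#  ≈⟨ +-congʳ (*-cong ([1-x]^-0 (- γ)) ([1-x]^-0 γ)) ⟩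
      1# * 1# + 0#     ≈⟨ solve 0 (:1 :* :1 :+ :0 := :1) refl ⟩
      1#               ∎
    conclusion (suc k) = *-cancelˡ (0<x⇒x≉0 (fromℕ-positive k)) (trans (θG≈0 (suc k)) (sym (zeroʳ (fromℕ (suc k)))))

  -- The Rodrigues formula

  -- (θ + a) (p (1 - x)^(γ + 1)) = (T a (γ + 1) p) (1 - x)^γ.
  T-⊛ : ∀ a γ p k → (fromℕ k + a) * (p ⊛ [1-x]^ (γ + 1#)) k ≈ (T a (γ + 1#) p ⊛ [1-x]^ γ) k
  T-⊛ a γ p k = begin
    (fromℕ k + a) * (p ⊛ e⁺) k
      ≈⟨ solve 3 (λ n a u → (n :+ a) :* u := n :* u :+ a :* u) refl (fromℕ k) a ((p ⊛ e⁺) k) ⟩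
    θ (p ⊛ e⁺) k + a * (p ⊛ e⁺) k
      ≈⟨ +-congʳ (θ-⊛ p e⁺ k) ⟩
    (θ p ⊛ e⁺) k + (p ⊛ θ e⁺) k + a * (p ⊛ e⁺) k
      ≈⟨ solve 3 (λ u v w → u :+ v :+ w := u :+ w :+ v) refl ((θ p ⊛ e⁺) k) ((p ⊛ θ e⁺) k) (a * (p ⊛ e⁺) k) ⟩
    (θ p ⊛ e⁺) k + a * (p ⊛ e⁺) k + (p ⊛ θ e⁺) k
      ≈⟨ +-cong q⊛e⁺ p⊛θe⁺ ⟩
    (q ⊛ e) k - shift (q ⊛ e) k + - (γ + 1#) * shift (p ⊛ e) k
      ≈⟨ collect k ⟩
    (q ⊛ e) k - shift (λ i → (q ⊛ e) i + (γ + 1#) * (p ⊛ e) i) k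
      ≈⟨ +-congˡ (-‿cong (shift-cong q+γp k)) ⟩
    (q ⊛ e) k - shift ((λ i → (fromℕ i + a + (γ + 1#)) * p i) ⊛ e) k
      ≈⟨ +-congˡ (-‿cong (⊛-shiftˡ (λ i → (fromℕ i + a + (γ + 1#)) * p i) e k)) ⟨
    (q ⊛ e) k - (shift (λ i → (fromℕ i + a + (γ + 1#)) * p i) ⊛ e) k
      ≈⟨ ⊛-distribʳ-minus q (shift (λ i → (fromℕ i + a + (γ + 1#)) * p i)) e k ⟨
    (T a (γ + 1#) p ⊛ e) k
      ∎
    where
    e e⁺ q : Series
    e  = [1-x]^ γ
    e⁺ = [1-x]^ (γ + 1#)
    q i = (fromℕ i + a) * p i

    q⊛e⁺ : (θ p ⊛ e⁺) k + a * (p ⊛ e⁺) k ≈ (q ⊛ e) k - shift (q ⊛ e) k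
    q⊛e⁺ = begin
      (θ p ⊛ e⁺) k + a * (p ⊛ e⁺) k                ≈⟨ +-congˡ (⊛-scaleˡ a p e⁺ k) ⟨
      (θ p ⊛ e⁺) k + ((λ i → a * p i) ⊛ e⁺) k      ≈⟨ ⊛-distribʳ-+ (θ p) (λ i → a * p i) e⁺ k ⟨
      ((λ i → θ p i + a * p i) ⊛ e⁺) k
        ≈⟨ ⊛-cong (λ i → solve 3 (λ n a u → n :* u :+ a :* u := (n :+ a) :* u) refl (fromℕ i) a (p i)) ([1-x]^[γ+1] γ) k ⟩
      (q ⊛ (λ i → e i - shift e i)) k              ≈⟨ ⊛-distribˡ-minus q e (shift e) k ⟩
      (q ⊛ e) k - (q ⊛ shift e) k                  ≈⟨ +-congˡ (-‿cong (⊛-shiftʳ q e k)) ⟩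
      (q ⊛ e) k - shift (q ⊛ e) k                  ∎

    p⊛θe⁺ : (p ⊛ θ e⁺) k ≈ - (γ + 1#) * shift (p ⊛ e) k
    p⊛θe⁺ = begin
      (p ⊛ θ e⁺) k                                 ≈⟨ ⊛-cong {p} (λ _ → refl) (θ[1-x]^[γ+1] γ) k ⟩
      (p ⊛ (λ i → - (γ + 1#) * shift e i)) k       ≈⟨ ⊛-scaleʳ (- (γ + 1#)) p (shift e) k ⟩
      - (γ + 1#) * (p ⊛ shift e) k                 ≈⟨ *-congˡ (⊛-shiftʳ p e k) ⟩
      - (γ + 1#) * shift (p ⊛ e) k                 ∎

    collect : ∀ k → (q ⊛ e) k - shift (q ⊛ e) k + - (γ + 1#) * shift (p ⊛ e) k ≈
                    (q ⊛ e) k - shift (λ i → (q ⊛ e) i + (γ + 1#) * (p ⊛ e) i) k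
    collect zero    = solve 2 (λ u g → u :- :0 :+ (:- g) :* :0 := u :- :0) refl ((q ⊛ e) 0) (γ + 1#)
    collect (suc k) = solve 4 (λ u g v w → u :- v :+ (:- g) :* w := u :- (v :+ g :* w)) refl
      ((q ⊛ e) (suc k)) (γ + 1#) ((q ⊛ e) k) ((p ⊛ e) k)

    q+γp : (λ i → (q ⊛ e) i + (γ + 1#) * (p ⊛ e) i) ≋ (λ i → (fromℕ i + a + (γ + 1#)) * p i) ⊛ e
    q+γp i = begin
      (q ⊛ e) i + (γ + 1#) * (p ⊛ e) i             ≈⟨ +-congˡ (⊛-scaleˡ (γ + 1#) p e i) ⟨
      (q ⊛ e) i + ((λ j → (γ + 1#) * p j) ⊛ e) i   ≈⟨ ⊛-distribʳ-+ q (λ j → (γ + 1#) * p j) e i ⟨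
      ((λ j → q j + (γ + 1#) * p j) ⊛ e) i
        ≈⟨ ⊛-cong {g = e} (λ j → solve 3 (λ u g v → u :* v :+ g :* v := (u :+ g) :* v) refl (fromℕ j + a) (γ + 1#) (p j)) (λ _ → refl) i ⟩
      ((λ j → (fromℕ j + a + (γ + 1#)) * p j) ⊛ e) i  ∎

  -- The eigenvalue of the operator ∏ (θ + a) on x^k, that is ∏ (k + a).
  weight : List Carrier → ℕ → Carrier
  weight as k = foldr (λ a w → (fromℕ k + a) * w) 1# as

  weight-++ : ∀ as bs k → weight (as ++ bs) k ≈ weight as k * weight bs k
  weight-++ []       bs k = sym (*-identityˡ _)
  weight-++ (a ∷ as) bs k = trans (*-congˡ (weight-++ as bs k)) (sym (*-assoc _ _ _))

  weight-[1-x]^ : ∀ as γ → (λ k → weight as k * ([1-x]^ (γ + fromℕ (length as))) k) ≋ rodrigues as γ ⊛ [1-x]^ γ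
  weight-[1-x]^ [] γ k = begin
    1# * ([1-x]^ (γ + 0#)) k   ≈⟨ *-identityˡ _ ⟩
    ([1-x]^ (γ + 0#)) k        ≈⟨ [1-x]^-cong (+-identityʳ γ) k ⟩
    ([1-x]^ γ) k               ≈⟨ ⊛-identityˡ ([1-x]^ γ) k ⟨
    (one ⊛ [1-x]^ γ) k         ∎
  weight-[1-x]^ (a ∷ as) γ k = begin
    (fromℕ k + a) * weight as k * ([1-x]^ (γ + (1# + fromℕ (length as)))) k
      ≈⟨ *-assoc _ _ _ ⟩
    (fromℕ k + a) * (weight as k * ([1-x]^ (γ + (1# + fromℕ (length as)))) k)
      ≈⟨ *-congˡ (*-congˡ ([1-x]^-cong (solve 2 (λ g l → g :+ (:1 :+ l) := g :+ :1 :+ l) refl γ (fromℕ (length as))) k)) ⟩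
    (fromℕ k + a) * (weight as k * ([1-x]^ (γ + 1# + fromℕ (length as))) k)
      ≈⟨ *-congˡ (weight-[1-x]^ as (γ + 1#) k) ⟩
    (fromℕ k + a) * (rodrigues as (γ + 1#) ⊛ [1-x]^ (γ + 1#)) k
      ≈⟨ T-⊛ a γ (rodrigues as (γ + 1#)) k ⟩
    (rodrigues (a ∷ as) γ ⊛ [1-x]^ γ) k
      ∎

  -- The numbers b, b + 1, ..., b + m - 1, in descending order.
  shifts : Carrier → ℕ → List Carrier
  shifts b zero    = []
  shifts b (suc m) = (b + fromℕ m) ∷ shifts b m

  -- The list of all numbers αⱼ + 1 + i with 0 ≤ i < nⱼ.
  parameters : ∀ {r} → Vector ℕ r → Vector Carrier r → List Carrier
  parameters {zero}  𝐧 α = []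
  parameters {suc r} 𝐧 α = shifts (α zero + 1#) (𝐧 zero) ++ parameters (𝐧 ∘ suc) (α ∘ suc)

  length-shifts : ∀ b m → length (shifts b m) ≡ m
  length-shifts b zero    = ≡.refl
  length-shifts b (suc m) = ≡.cong suc (length-shifts b m)

  length-parameters : ∀ {r} (𝐧 : Vector ℕ r) α → length (parameters 𝐧 α) ≡ ∣ 𝐧 ∣
  length-parameters {zero}  𝐧 α = ≡.refl
  length-parameters {suc r} 𝐧 α = ≡.trans (length-++ (shifts (α zero + 1#) (𝐧 zero)))
    (≡.cong₂ ℕ._+_ (length-shifts (α zero + 1#) (𝐧 zero)) (length-parameters (𝐧 ∘ suc) (α ∘ suc)))

  parameters-all : ∀ {r} (Q : Carrier → Set) (𝐧 : Vector ℕ r) α →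
                   (∀ j i → Q (α j + 1# + fromℕ i)) → All Q (parameters 𝐧 α)
  parameters-all {zero}  Q 𝐧 α q = []
  parameters-all {suc r} Q 𝐧 α q = ++⁺ (shifts-all (𝐧 zero)) (parameters-all Q (𝐧 ∘ suc) (α ∘ suc) (q ∘ suc))
    where
    shifts-all : ∀ m → All Q (shifts (α zero + 1#) m)
    shifts-all zero    = []
    shifts-all (suc m) = q zero m ∷ shifts-all m

  -- (b + m)ₖ (b)ₘ = (b + k)ₘ (b)ₖ; both sides are the Pochhammer symbol of b of length k + m.
  weight-shifts : ∀ b m k → pochhammer (b + fromℕ m) k * pochhammer b m ≈ weight (shifts b m) k * pochhammer b k
  weight-shifts b zero k = trans (*-congʳ (pochhammer-cong (+-identityʳ b) k)) (*-comm _ _)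
  weight-shifts b (suc m) k = begin
    pochhammer (b + (1# + fromℕ m)) k * (pochhammer b m * (b + fromℕ m))
      ≈⟨ *-congʳ (pochhammer-cong (solve 2 (λ b m → b :+ (:1 :+ m) := b :+ m :+ :1) refl b (fromℕ m)) k) ⟩
    pochhammer (b + fromℕ m + 1#) k * (pochhammer b m * (b + fromℕ m))
      ≈⟨ solve 3 (λ p q c → p :* (q :* c) := c :* p :* q) refl (pochhammer (b + fromℕ m + 1#) k) (pochhammer b m) (b + fromℕ m) ⟩
    (b + fromℕ m) * pochhammer (b + fromℕ m + 1#) k * pochhammer b m
      ≈⟨ *-congʳ (pochhammer-suc (b + fromℕ m) k) ⟨
    pochhammer (b + fromℕ m) k * (b + fromℕ m + fromℕ k) * pochhammer b m
      ≈⟨ solve 4 (λ p c k q → p :* (c :+ k) :* q := (k :+ c) :* (p :* q)) refl (pochhammer (b + fromℕ m) k) (b + fromℕ m) (fromℕ k) (pochhammer b m) ⟩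
    (fromℕ k + (b + fromℕ m)) * (pochhammer (b + fromℕ m) k * pochhammer b m)
      ≈⟨ *-congˡ (weight-shifts b m k) ⟩
    (fromℕ k + (b + fromℕ m)) * (weight (shifts b m) k * pochhammer b k)
      ≈⟨ *-assoc _ _ _ ⟨
    (fromℕ k + (b + fromℕ m)) * weight (shifts b m) k * pochhammer b k
      ∎

  weight-parameters : ∀ {r} (𝐧 : Vector ℕ r) α k →
    product (λ j → pochhammer (α j + fromℕ (𝐧 j) + 1#) k) * product (λ j → pochhammer (α j + 1#) (𝐧 j)) ≈
    weight (parameters 𝐧 α) k * product (λ j → pochhammer (α j + 1#) k)
  weight-parameters {zero}  𝐧 α k = refl
  weight-parameters {suc r} 𝐧 α k = begin
    (p * N) * (q * A)
      ≈⟨ *-congʳ (*-congʳ (pochhammer-cong (solve 2 (λ a m → a :+ m :+ :1 := a :+ :1 :+ m) refl (α zero) (fromℕ (𝐧 zero))) k)) ⟩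
    (p′ * N) * (q * A)
      ≈⟨ interchange p′ N q A ⟩
    (p′ * q) * (N * A)
      ≈⟨ *-cong (weight-shifts (α zero + 1#) (𝐧 zero) k) (weight-parameters (𝐧 ∘ suc) (α ∘ suc) k) ⟩
    (w * s) * (W * D)
      ≈⟨ interchange w s W D ⟩
    (w * W) * (s * D)
      ≈⟨ *-congʳ (weight-++ (shifts (α zero + 1#) (𝐧 zero)) (parameters (𝐧 ∘ suc) (α ∘ suc)) k) ⟨
    weight (parameters 𝐧 α) k * (s * D)
      ∎
    where
    interchange : ∀ a b c d → (a * b) * (c * d) ≈ (a * c) * (b * d)
    interchange = solve 4 (λ a b c d → (a :* b) :* (c :* d) := (a :* c) :* (b :* d)) refl
    p  = pochhammer (α zero + fromℕ (𝐧 zero) + 1#) k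
    p′ = pochhammer (α zero + 1# + fromℕ (𝐧 zero)) k
    q  = pochhammer (α zero + 1#) (𝐧 zero)
    s  = pochhammer (α zero + 1#) k
    w  = weight (shifts (α zero + 1#) (𝐧 zero)) k
    N  = product (λ j → pochhammer (α (suc j) + fromℕ (𝐧 (suc j)) + 1#) k)
    A  = product (λ j → pochhammer (α (suc j) + 1#) (𝐧 (suc j)))
    W  = weight (parameters (𝐧 ∘ suc) (α ∘ suc)) k
    D  = product (λ j → pochhammer (α (suc j) + 1#) k)

  product-positive : ∀ {r} (v : Vector Carrier r) → (∀ j → 0# < v j) → 0# < product v
  product-positive {zero}  v 0<v = 0<1
  product-positive {suc r} v 0<v = *-positive (0<v zero) (product-positive (v ∘ suc) (0<v ∘ suc))

  [-1]^-nonzero : ∀ n → ¬ ((- 1#) ^ n ≈ 0#)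
  [-1]^-nonzero zero    = 0<x⇒x≉0 0<1
  [-1]^-nonzero (suc n) = *-nonzero (0<x⇒-x≉0 0<1) ([-1]^-nonzero n)

  ⁻¹-nonzero : ∀ {x} → 0# < x → ¬ (x ⁻¹ ≈ 0#)
  ⁻¹-nonzero 0<x = 0<x⇒x≉0 (⁻¹-positive 0<x)

  module _ {r} (𝐧 : Vector ℕ r) (α : Vector Carrier r) (β : Carrier) (-1<α : ∀ j → - 1# < α j) where
    private
      n : ℕ
      n = ∣ 𝐧 ∣

      as : List Carrier
      as = parameters 𝐧 α

      A : Carrier
      A = product (λ j → pochhammer (α j + 1#) (𝐧 j))

      0<A : 0# < A
      0<A = product-positive _ (λ j → pochhammer-positive (-1<γ⇒0<γ+1 (-1<α j)) (𝐧 j))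

      hyper : Series
      hyper = hypergeometric ((- fromℕ n - β) Vector.∷ (λ j → α j + fromℕ (𝐧 j) + 1#)) (λ j → α j + 1#)

    -- The hypergeometric series is, up to the factor A, the image of (1 - x)^(n + β) under
    -- the product of the operators θ + a.
    hypergeometric-weight : hyper ≋ (λ k → A ⁻¹ * (weight as k * ([1-x]^ (β + fromℕ (length as))) k))
    hypergeometric-weight k = *-cancelˡ (0<x⇒x≉0 0<A) (*-cancelˡ (0<x⇒x≉0 (*-positive 0<D (fromℕ!-positive k))) (begin
      D * F * (A * (p * N * (D * F) ⁻¹))
        ≈⟨ solve 6 (λ d f a p n i → d :* f :* (a :* (p :* n :* i)) := d :* f :* i :* (p :* (n :* a))) refl D F A p N ((D * F) ⁻¹) ⟩
      D * F * (D * F) ⁻¹ * (p * (N * A))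
        ≈⟨ *-cong (⁻¹-inverseʳ (0<x⇒x≉0 (*-positive 0<D (fromℕ!-positive k)))) (*-congˡ (weight-parameters 𝐧 α k)) ⟩
      1# * (p * (W * D))
        ≈⟨ *-congˡ (*-congʳ (pochhammer-cong exponent k)) ⟩
      1# * (p′ * (W * D))
        ≈⟨ solve 3 (λ p w d → :1 :* (p :* (w :* d)) := :1 :* (:1 :* (p :* (w :* d)))) refl p′ W D ⟩
      1# * (1# * (p′ * (W * D)))
        ≈⟨ *-cong (⁻¹-inverseʳ (0<x⇒x≉0 (fromℕ!-positive k))) (*-congʳ (⁻¹-inverseʳ (0<x⇒x≉0 0<A))) ⟨
      F * F ⁻¹ * (A * A ⁻¹ * (p′ * (W * D)))
        ≈⟨ rearrange ⟩
      D * F * (A * (A ⁻¹ * (W * (p′ * F ⁻¹))))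
        ∎))
      where
      D F p p′ N W : Carrier
      D = product (λ j → pochhammer (α j + 1#) k)
      F = fromℕ (k !)
      p = pochhammer (- fromℕ n - β) k
      p′ = pochhammer (- (β + fromℕ (length as))) k
      N = product (λ j → pochhammer (α j + fromℕ (𝐧 j) + 1#) k)
      W = weight as k

      0<D : 0# < D
      0<D = product-positive _ (λ j → pochhammer-positive (-1<γ⇒0<γ+1 (-1<α j)) k)

      exponent : - fromℕ n - β ≈ - (β + fromℕ (length as))
      exponent = trans (solve 2 (λ n b → (:- n) :- b := :- (b :+ n)) refl (fromℕ n) β)
        (-‿cong (+-congˡ (reflexive (≡.cong fromℕ (≡.sym (length-parameters 𝐧 α))))))

      rearrange : F * F ⁻¹ * (A * A ⁻¹ * (p′ * (W * D))) ≈ D * F * (A * (A ⁻¹ * (W * (p′ * F ⁻¹))))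
      rearrange = begin
        F * F ⁻¹ * (A * A ⁻¹ * (p′ * (W * D)))
          ≈⟨ solve 6 (λ f i a p w d → f :* i :* (a :* (p :* (w :* d))) := d :* f :* (a :* (w :* (p :* i)))) refl F (F ⁻¹) (A * A ⁻¹) p′ W D ⟩
        D * F * (A * A ⁻¹ * (W * (p′ * F ⁻¹)))
          ≈⟨ *-congˡ (*-assoc _ _ _) ⟩
        D * F * (A * (A ⁻¹ * (W * (p′ * F ⁻¹))))
          ∎

    hypergeometric-rodrigues : [1-x]^ (- β) ⊛ hyper ≋ (λ k → A ⁻¹ * rodrigues as β k)
    hypergeometric-rodrigues k = begin
      (e⁻ ⊛ hyper) k                                 ≈⟨ ⊛-cong {e⁻} (λ _ → refl) hypergeometric-weight k ⟩
      (e⁻ ⊛ (λ i → A ⁻¹ * (weight as i * ([1-x]^ (β + fromℕ (length as))) i))) k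
        ≈⟨ ⊛-scaleʳ (A ⁻¹) e⁻ (λ i → weight as i * ([1-x]^ (β + fromℕ (length as))) i) k ⟩
      A ⁻¹ * (e⁻ ⊛ (λ i → weight as i * ([1-x]^ (β + fromℕ (length as))) i)) k
        ≈⟨ *-congˡ (⊛-cong {e⁻} (λ _ → refl) (weight-[1-x]^ as β) k) ⟩
      A ⁻¹ * (e⁻ ⊛ (p ⊛ e)) k                        ≈⟨ *-congˡ (⊛-cong {e⁻} (λ _ → refl) (⊛-comm p e) k) ⟩
      A ⁻¹ * (e⁻ ⊛ (e ⊛ p)) k                        ≈⟨ *-congˡ (⊛-assoc e⁻ e p k) ⟨
      A ⁻¹ * ((e⁻ ⊛ e) ⊛ p) k                        ≈⟨ *-congˡ (⊛-cong {g = p} ([1-x]^-inverse β) (λ _ → refl) k) ⟩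
      A ⁻¹ * (one ⊛ p) k                             ≈⟨ *-congˡ (⊛-identityˡ p k) ⟩
      A ⁻¹ * p k                                     ∎
      where
      e e⁻ p : Series
      e  = [1-x]^ β
      e⁻ = [1-x]^ (- β)
      p  = rodrigues as β

    P-rodrigues : (∀ j → 0# < fromℕ n + α j + β + 1#) →
                  ∃[ c ] ¬ (c ≈ 0#) × P 𝐧 α β ≋ (λ k → c * rodrigues as β k)
    P-rodrigues 0<n+α+β+1 = (- 1#) ^ n * A * B ⁻¹ * A ⁻¹ ,
      *-nonzero (*-nonzero (*-nonzero ([-1]^-nonzero n) (0<x⇒x≉0 0<A)) (⁻¹-nonzero 0<B)) (⁻¹-nonzero 0<A) ,
      λ k → trans (*-congˡ (hypergeometric-rodrigues k)) (sym (*-assoc _ _ _))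
      where
      B : Carrier
      B = product (λ j → pochhammer (fromℕ n + α j + β + 1#) (𝐧 j))

      0<B : 0# < B
      0<B = product-positive _ (λ j → pochhammer-positive (0<n+α+β+1 j) (𝐧 j))

  -- Complex zeros

  ∏-ofReal : ∀ zs k → ∏[x- map ofReal zs ] k ≈ᶜ ofReal (∏ zs k)
  ∏-ofReal []       zero    = refl , refl
  ∏-ofReal []       (suc k) = refl , refl
  ∏-ofReal (z ∷ zs) zero    with ∏-ofReal zs zero
  ... | re≈ , im≈ =
    +-congˡ (-‿cong (trans (+-cong (*-congˡ re≈) (-‿cong (*-congˡ im≈)))
      (solve 2 (λ z u → z :* u :- :0 :* :0 := z :* u) refl z (∏ zs 0)))) ,
    trans (+-congˡ (-‿cong (+-cong (*-congˡ im≈) (*-congˡ re≈))))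
      (solve 2 (λ z u → :0 :- (z :* :0 :+ :0 :* u) := :0) refl z (∏ zs 0))
  ∏-ofReal (z ∷ zs) (suc k) with ∏-ofReal zs k | ∏-ofReal zs (suc k)
  ... | re≈₀ , im≈₀ | re≈ , im≈ =
    +-cong re≈₀ (-‿cong (trans (+-cong (*-congˡ re≈) (-‿cong (*-congˡ im≈)))
      (solve 2 (λ z u → z :* u :- :0 :* :0 := z :* u) refl z (∏ zs (suc k))))) ,
    trans (+-cong im≈₀ (-‿cong (+-cong (*-congˡ im≈) (*-congˡ re≈))))
      (solve 2 (λ z u → :0 :- (z :* :0 :+ :0 :* u) := :0) refl z (∏ zs (suc k)))

  hasZeros : ∀ {f c} zs → ¬ (c ≈ 0#) → f ≋ (λ k → c * ∏ zs k) → f HasZeros map ofReal zs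
  hasZeros {f} {c} zs c≉0 f≋ = ofReal c , (λ c≈0 → c≉0 (proj₁ c≈0)) , λ k →
    trans (f≋ k) (trans (solve 2 (λ c u → c :* u := c :* u :- :0 :* :0) refl c (∏ zs k))
      (sym (+-cong (*-congˡ (proj₁ (∏-ofReal zs k))) (-‿cong (*-congˡ (proj₂ (∏-ofReal zs k))))))) ,
    trans (solve 2 (λ c u → :0 := c :* :0 :+ :0 :* u) refl c (∏ zs k))
      (sym (+-cong (*-congˡ (proj₂ (∏-ofReal zs k))) (*-congˡ (proj₁ (∏-ofReal zs k)))))

  descending-⟨0,1⟩ : ∀ zs → Descending 1# zs → All ⟨0,1⟩ (map ofReal zs)
  descending-⟨0,1⟩ zs zs↓ = All.map⁺ (All.map (refl ,_) (descending-all zs zs↓))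

  size-positive : ∀ {r} (𝐧 : Vector ℕ r) → 1 ℕ.≤ r → (∀ j → 1 ℕ.≤ 𝐧 j) → 1 ℕ.≤ ∣ 𝐧 ∣
  size-positive {suc r} 𝐧 _ 1≤𝐧 = ℕ.≤-trans (1≤𝐧 zero) (ℕ.m≤m+n (𝐧 zero) _)

  module _ {r} (1≤r : 1 ℕ.≤ r) (𝐧 : Vector ℕ r) (1≤𝐧 : ∀ j → 1 ℕ.≤ 𝐧 j)
                 (α : Vector Carrier r) (-1<α : ∀ j → - 1# < α j) (β : Carrier) where
    private
      as : List Carrier
      as = parameters 𝐧 α

    0<as : All (0# <_) as
    0<as = parameters-all (0# <_) 𝐧 α (λ j i → +-pos-nonneg (-1<γ⇒0<γ+1 (-1<α j)) (fromℕ-nonneg i))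

    zeros-in-⟨0,1⟩ : - 1# < β → ∃[ zs ] P 𝐧 α β HasZeros zs × All ⟨0,1⟩ zs
    zeros-in-⟨0,1⟩ -1<β = map ofReal Z.zeros ,
      hasZeros Z.zeros (*-nonzero (proj₁ (proj₂ cP)) Z.scalar≉0)
        (λ k → trans (proj₂ (proj₂ cP) k) (trans (*-congˡ (Z.factorised k)) (sym (*-assoc _ _ _)))) ,
      descending-⟨0,1⟩ Z.zeros Z.descending
      where
      module Z = ZerosInUnitInterval (rodrigues-zeros as β 0<as -1<β)

      0<n+α+β+1 : ∀ {n} → 1 ℕ.≤ n → ∀ j → 0# < fromℕ n + α j + β + 1#
      0<n+α+β+1 {suc m} _ j = <-respʳ-≈
        (solve 3 (λ m a b → (a :+ :1) :+ (b :+ :1) :+ m := :1 :+ m :+ a :+ b :+ :1) refl (fromℕ m) (α j) β)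
        (+-pos-nonneg (+-positive (-1<γ⇒0<γ+1 (-1<α j)) (-1<γ⇒0<γ+1 -1<β)) (fromℕ-nonneg m))

      cP = P-rodrigues 𝐧 α β -1<α (0<n+α+β+1 (size-positive 𝐧 1≤r 1≤𝐧))

    zeros-but-one-in-⟨0,1⟩ : - (1# + 1#) < β → β ≤ - 1# → (∣ 𝐧 ∣ ≡ 1 → ∀ j → 0# < fromℕ ∣ 𝐧 ∣ + α j + β + 1#) →
         ∃[ w ] ∃[ zs ] P 𝐧 α β HasZeros (w ∷ zs) × All ⟨0,1⟩ zs × [1,∞⟩ w
    zeros-but-one-in-⟨0,1⟩ -2<β β≤-1 n≡1⇒ = ofReal Z.last , map ofReal Z.zeros ,
      hasZeros (Z.last ∷ Z.zeros) (*-nonzero (proj₁ (proj₂ cP)) Z.scalar≉0)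
        (λ k → trans (proj₂ (proj₂ cP) k) (trans (*-congˡ (Z.factorised k)) (sym (*-assoc _ _ _)))) ,
      descending-⟨0,1⟩ Z.zeros Z.descending ,
      (refl , Z.1≤last)
      where
      0<β+2 : 0# < β + (1# + 1#)
      0<β+2 = <-respʳ-≈ (solve 1 (λ b → b :- (:- (:1 :+ :1)) := b :+ (:1 :+ :1)) refl β) (x<y⇒0<y-x -2<β)

      0<m+α+β+1 : ∀ {m} → 1 ℕ.≤ m → (m ≡ 1 → ∀ j → 0# < fromℕ m + α j + β + 1#) → ∀ j → 0# < fromℕ m + α j + β + 1#
      0<m+α+β+1 {suc zero}    _ m≡1⇒ = m≡1⇒ ≡.refl
      0<m+α+β+1 {suc (suc m)} _ _ j = <-respʳ-≈
        (solve 3 (λ m a b → (a :+ :1) :+ (b :+ (:1 :+ :1)) :+ m := :1 :+ (:1 :+ m) :+ a :+ b :+ :1) refl (fromℕ m) (α j) β)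
        (+-pos-nonneg (+-positive (-1<γ⇒0<γ+1 (-1<α j)) 0<β+2) (fromℕ-nonneg m))

      1≤n : 1 ℕ.≤ ∣ 𝐧 ∣
      1≤n = size-positive 𝐧 1≤r 1≤𝐧

      0<n+α+β+1 : ∀ j → 0# < fromℕ ∣ 𝐧 ∣ + α j + β + 1#
      0<n+α+β+1 = 0<m+α+β+1 1≤n n≡1⇒

      cP = P-rodrigues 𝐧 α β -1<α 0<n+α+β+1

      beyond : ∀ as → 1 ℕ.≤ length as → All (0# <_) as → All (λ a → 0# < fromℕ (length as) + a + β) as → ZerosBeyond (rodrigues as β)
      beyond (a ∷ as) _ 0<as (0<n+a+β ∷ _) = rodrigues-zeros-beyond a as β 0<as -2<β β≤-1
        (<-respʳ-≈ (solve 3 (λ l a b → :1 :+ l :+ a :+ b := l :+ a :+ (b :+ :1)) refl (fromℕ (length as)) a β) 0<n+a+β)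

      module Z = ZerosBeyond (beyond as
        (≡.subst (1 ℕ.≤_) (≡.sym (length-parameters 𝐧 α)) 1≤n) 0<as
        (parameters-all _ 𝐧 α (λ j i → ≡.subst (λ m → 0# < fromℕ m + (α j + 1# + fromℕ i) + β) (≡.sym (length-parameters 𝐧 α))
          (<-respʳ-≈ (solve 4 (λ n a b i → (n :+ a :+ b :+ :1) :+ i := n :+ (a :+ :1 :+ i) :+ b) refl (fromℕ ∣ 𝐧 ∣) (α j) β (fromℕ i))
            (+-pos-nonneg (0<n+α+β+1 j) (fromℕ-nonneg i))))))

mainTheorem8 : (ℝ : CompleteOrderedField) → let open JacobiPiñeiro ℝ in
    (r : ℕ) → 1 ≤ℕ r →
    (𝐧 : Vector ℕ r) → (∀ j → 1 ≤ℕ 𝐧 j) →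
    (α : Vector Carrier r) → (∀ j → - 1# < α j) →
    (β : Carrier) →
    (- 1# < β →
      ∃[ zs ] P 𝐧 α β HasZeros zs × All ⟨0,1⟩ zs)
    ×
    (- (1# + 1#) < β → β ≤ - 1# →
      -- For n = 1 the only zero is (α₁ + 1) / (α₁ + β + 2): negative if α₁ + β + 2 < 0.
      (∣ 𝐧 ∣ ≡ 1 → ∀ j → 0# < fromℕ ∣ 𝐧 ∣ + α j + β + 1#) →
      ∃[ w ] ∃[ zs ] P 𝐧 α β HasZeros (w ∷ zs) × All ⟨0,1⟩ zs × [1,∞⟩ w)
mainTheorem8 ℝ r 1≤r 𝐧 1≤𝐧 α -1<α β =
  zeros-in-⟨0,1⟩ 1≤r 𝐧 1≤𝐧 α -1<α β , zeros-but-one-in-⟨0,1⟩ 1≤r 𝐧 1≤𝐧 α -1<α β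
  where open JacobiPiñeiroZeros ℝ
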